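{- Let $G$ be a finite Cayley integral group. Then $G$ contains two non-commuting elements of order $2$ if and only if $G\cong S_3$.
   Context: For a finite group $G$ with identity $1$ and a subset $S\subseteq G\setminus\{1\}$ with $S=S^{ -1}$, the undirected Cayley graph $Cay(G,S)$ has vertex set $G$, with vertices $a,b$ adjacent whenever $ab^{ -1}\in S$. A graph is integral if all eigenvalues of its adjacency matrix are integers. A finite group $G$ is called Cayley integral if $Cay(G,S)$ is integral for every such subset $S$. -}

module Defs where

open import Data.Nat using (ℕ; zero; suc)
open import Data.Fin using (Fin; zero; suc; punchIn; _≟_)
open import Data.Integer using (ℤ; 0ℤ; 1ℤ; _+_; _*_; _-_; -_)
open import Data.Bool using (Bool; true; false; if_then_else_)
open import Data.Vec using (Vec; lookup; tabulate)
open import Data.Product using (Σ; ∃; _×_; _,_)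
open import Function.Definitions using (Injective)
open import Relation.Nullary using (¬_; yes; no)
open import Relation.Binary.PropositionalEquality using (_≡_; _≢_)
open import Algebra.Structures using (IsGroup)

-- Finite groups: a group structure (w.r.t. propositional equality) on Fin n.
-- Every finite group is isomorphic to one of these.

record FiniteGroup : Set where
  field
    order   : ℕ
    _∙_     : Fin order → Fin order → Fin order
    ε       : Fin order
    _⁻¹     : Fin order → Fin order
    isGroup : IsGroup _≡_ _∙_ ε _⁻¹

Matrix : ℕ → Set
Matrix n = Fin n → Fin n → ℤ

∑ : ∀ {n} → (Fin n → ℤ) → ℤ
∑ {zero}  f = 0ℤ
∑ {suc n} f = f zero + ∑ (λ i → f (suc i))

∏ : ∀ {n} → (Fin n → ℤ) → ℤ
∏ {zero}  f = 1ℤ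
∏ {suc n} f = f zero * ∏ (λ i → f (suc i))

sign : ℕ → ℤ
sign zero    = 1ℤ
sign (suc k) = - sign k

toℕ' : ∀ {n} → Fin n → ℕ
toℕ' zero    = zero
toℕ' (suc i) = suc (toℕ' i)

det : ∀ {n} → Matrix n → ℤ
det {zero}  M = 1ℤ
det {suc n} M =
  ∑ (λ j → sign (toℕ' j) * (M zero j * det (λ r c → M (suc r) (punchIn j c))))

δ : ∀ {n} → Fin n → Fin n → ℤ
δ i j with i ≟ j
... | yes _ = 1ℤ
... | no  _ = 0ℤ

charPolyAt : ∀ {n} → Matrix n → ℤ → ℤ
charPolyAt M x = det (λ i j → x * δ i j - M i j)

-- All eigenvalues of M are integers: the characteristic polynomial
-- det (x I - M) (monic of degree n) factors as ∏ (x - λᵢ) with λᵢ ∈ ℤ.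
-- Two integer polynomials are equal iff they agree at every integer x.
AllEigenvaluesIntegral : ∀ {n} → Matrix n → Set
AllEigenvaluesIntegral {n} M =
  Σ (Fin n → ℤ) λ λs → ∀ (x : ℤ) → charPolyAt M x ≡ ∏ (λ i → x - λs i)

module _ (G : FiniteGroup) where
  open FiniteGroup G

  ConnectionSet : (Fin order → Bool) → Set
  ConnectionSet S = (S ε ≡ false) × (∀ g → S (g ⁻¹) ≡ S g)

  cayleyAdj : (Fin order → Bool) → Matrix order
  cayleyAdj S a b = if S (a ∙ (b ⁻¹)) then 1ℤ else 0ℤ

  IsIntegralCayley : (Fin order → Bool) → Set
  IsIntegralCayley S = AllEigenvaluesIntegral (cayleyAdj S)

  CayleyIntegral : Set
  CayleyIntegral = ∀ (S : Fin order → Bool) → ConnectionSet S → IsIntegralCayley S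

  HasOrderTwo : Fin order → Set
  HasOrderTwo x = (x ≢ ε) × (x ∙ x ≡ ε)

  HasNonCommutingInvolutions : Set
  HasNonCommutingInvolutions =
    ∃ λ x → ∃ λ y → HasOrderTwo x × HasOrderTwo y × ((x ∙ y) ≢ (y ∙ x))

  -- The symmetric group S₃ = Sym({0,1,2}); a permutation σ is stored as
  -- the vector (σ 0, σ 1, σ 2).  Composition: (σ ∘ τ) i = σ (τ i).

  IsPermutation3 : Vec (Fin 3) 3 → Set
  IsPermutation3 v = Injective _≡_ _≡_ (lookup v)

  compose3 : Vec (Fin 3) 3 → Vec (Fin 3) 3 → Vec (Fin 3) 3
  compose3 σ τ = tabulate (λ i → lookup σ (lookup τ i))

  IsomorphicToS3 : Set
  IsomorphicToS3 =
    Σ (Fin order → Vec (Fin 3) 3) λ φ →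
      (∀ a → IsPermutation3 (φ a)) ×
      (∀ a b → φ (a ∙ b) ≡ compose3 (φ a) (φ b)) ×
      Injective _≡_ _≡_ φ ×
      (∀ σ → IsPermutation3 σ → ∃ λ a → φ a ≡ σ)

{-# OPTIONS --safe #-}
module Submission where

-- If all eigenvalues of an integer matrix M are integers, then by Cayley-Hamilton every nonzero
-- M-invariant family of vectors contains an integral eigenvector. For a connection set {p, q} the
-- eigenvalues lie in {0, ±1, ±2}, so that M⁵ - 5M³ + 4M = 0; comparing walks in the Cayley graph,
-- two non-commuting involutions have a product of order 3, and elements have order dividing 4 or 6.
-- Let x, y be non-commuting involutions. An involution commuting with x is x itself, since otherwise
-- a quotient of S₄ collapses. An element g ≠ 1 centralizing x and y would have order 3, but then
-- {x g, x g⁻¹, y} has the eigenvalue √3. A fourth involution t besides x, y and x y x would make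
-- x y and x t commuting rotations, and then {x, y, t} has the eigenvalue √3. Hence the group acts
-- faithfully by conjugation on its three involutions.

open import Defs
open import Function.Bundles using (_⇔_; mk⇔)

open import Algebra.Bundles using (Group)
import Algebra.Properties.Group as GroupProperties
open import Data.Bool using (Bool; if_then_else_)
open import Data.Empty using (⊥; ⊥-elim)
open import Data.Fin using (Fin; zero; suc; punchIn; _≟_)
open import Data.Fin.Patterns using (0F; 1F; 2F)
open import Data.Fin.Permutation using (Permutation′; permutation)
open import Data.Fin.Properties using (suc-injective)
open import Data.Integer using (ℤ; 0ℤ; 1ℤ; -1ℤ; _+_; _*_; _-_; -_; ∣_∣; -[1+_]) renaming (+_ to pos)
import Data.Integer.Properties as ℤ
open import Data.Integer.Tactic.RingSolver using (solve-∀)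
open import Data.List using (List; []; _∷_; foldr)
import Data.List.Membership.DecPropositional as DecMembership
open import Data.List.Membership.Propositional using (_∈_; _∉_)
open import Data.List.Relation.Unary.All using ([]; _∷_)
open import Data.List.Relation.Unary.All.Properties using (All¬⇒¬Any)
open import Data.List.Relation.Unary.AllPairs using ([]; _∷_)
open import Data.List.Relation.Unary.Any using (here; there)
open import Data.List.Relation.Unary.Unique.Propositional using (Unique)
import Data.Nat as ℕ
open import Data.Nat using (ℕ; zero; suc)
import Data.Nat.Properties as ℕ
open import Data.Product using (Σ; ∃; _×_; _,_; proj₁; proj₂)
open import Data.Sum using (_⊎_; inj₁; inj₂; [_,_]′)
open import Data.Vec using (Vec; []; _∷_; lookup; tabulate)
open import Data.Vec.Functional using (updateAt)
open import Data.Vec.Functional.Properties using (updateAt-updates; updateAt-minimal)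
open import Data.Vec.Properties using (lookup∘tabulate; tabulate∘lookup; tabulate-cong)
open import Function using (_∘_; const; id)
open import Relation.Binary.PropositionalEquality
open import Relation.Nullary using (¬_; Dec; yes; no; does; contradiction)
open import Relation.Nullary.Decidable using (dec-true; dec-false)

import Algebra.Properties.Semiring.Sum ℕ.+-*-semiring as ℕSum
import Algebra.Properties.Semiring.Sum ℤ.+-*-semiring as ℤSum

open ≡-Reasoning

-- Finite sums

-- Everything stays over ℤ: integrality is known only through values of a determinant at integers,
-- so no polynomial ring, complex eigenvector or diagonalization is available. Origin of the
-- quintic: for two generators the eigenvalues have the form 2 cos θ, and x⁵ - 5x³ + 4x becomes 2
-- cos 5θ - 2 cos θ, which vanishes exactly when 4θ or 6θ is a multiple of 2π. Its roots 0, ±1, ±2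
-- are all the integers bounded by the degree 2 of the graph. Origin of √3: the test vectors imitate
-- two-dimensional representations in which x, y, t are reflections X, Y, T. If g centralizes x and
-- y and acts as a primitive cube root of unity, x g + x g⁻¹ acts as -X, and (Y - X)² = 2 - (XY +
-- YX) = 3, because the rotation XY has order 3. If the rotation x y acts trivially and x t has
-- order 3, then x + y + t acts as 2X + T, and (2X + T)² = 5 + 2(XT + TX) = 3.

∑≡sum : ∀ {n} (f : Fin n → ℤ) → ∑ f ≡ ℤSum.sum f
∑≡sum {zero}  f = refl
∑≡sum {suc n} f = cong (f zero +_) (∑≡sum (f ∘ suc))

∑-cong : ∀ {n} {f g : Fin n → ℤ} → (∀ i → f i ≡ g i) → ∑ f ≡ ∑ g
∑-cong {zero}  f≡g = refl
∑-cong {suc n} f≡g = cong₂ _+_ (f≡g zero) (∑-cong (f≡g ∘ suc))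

∑-zero : ∀ {n} {f : Fin n → ℤ} → (∀ i → f i ≡ 0ℤ) → ∑ f ≡ 0ℤ
∑-zero {zero}  f≡0 = refl
∑-zero {suc n} f≡0 = cong₂ _+_ (f≡0 zero) (∑-zero (f≡0 ∘ suc))

∑-distrib-+ : ∀ {n} (f g : Fin n → ℤ) → ∑ (λ i → f i + g i) ≡ ∑ f + ∑ g
∑-distrib-+ f g = begin
  ∑ (λ i → f i + g i)       ≡⟨ ∑≡sum (λ i → f i + g i) ⟩
  ℤSum.sum (λ i → f i + g i) ≡⟨ ℤSum.∑-distrib-+ f g ⟩
  ℤSum.sum f + ℤSum.sum g   ≡⟨ cong₂ _+_ (∑≡sum f) (∑≡sum g) ⟨
  ∑ f + ∑ g                 ∎

*-distribˡ-∑ : ∀ {n} c (f : Fin n → ℤ) → c * ∑ f ≡ ∑ (λ i → c * f i)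
*-distribˡ-∑ c f = begin
  c * ∑ f                   ≡⟨ cong (c *_) (∑≡sum f) ⟩
  c * ℤSum.sum f            ≡⟨ ℤSum.*-distribˡ-sum c f ⟩
  ℤSum.sum (λ i → c * f i)  ≡⟨ ∑≡sum (λ i → c * f i) ⟨
  ∑ (λ i → c * f i)         ∎

∑-comm : ∀ {m n} (f : Fin m → Fin n → ℤ) → ∑ (λ i → ∑ (f i)) ≡ ∑ (λ j → ∑ (λ i → f i j))
∑-comm f = begin
  ∑ (λ i → ∑ (f i))                         ≡⟨ ∑-cong (λ i → ∑≡sum (f i)) ⟩
  ∑ (λ i → ℤSum.sum (f i))                  ≡⟨ ∑≡sum (λ i → ℤSum.sum (f i)) ⟩
  ℤSum.sum (λ i → ℤSum.sum (f i))           ≡⟨ ℤSum.∑-comm f ⟩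
  ℤSum.sum (λ j → ℤSum.sum (λ i → f i j))   ≡⟨ ∑≡sum (λ j → ℤSum.sum (λ i → f i j)) ⟨
  ∑ (λ j → ℤSum.sum (λ i → f i j))          ≡⟨ ∑-cong (λ j → ∑≡sum (λ i → f i j)) ⟨
  ∑ (λ j → ∑ (λ i → f i j))                 ∎

∑-δ : ∀ {n} (i : Fin n) (f : Fin n → ℤ) → ∑ (λ j → δ i j * f j) ≡ f i
∑-δ {suc n} zero f = begin
  1ℤ * f zero + ∑ (λ j → δ zero (suc j) * f (suc j))
    ≡⟨ cong₂ _+_ (ℤ.*-identityˡ (f zero)) (∑-zero (λ j → ℤ.*-zeroˡ (f (suc j)))) ⟩
  f zero + 0ℤ  ≡⟨ ℤ.+-identityʳ (f zero) ⟩
  f zero       ∎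
∑-δ {suc n} (suc i) f = begin
  0ℤ * f zero + ∑ (λ j → δ (suc i) (suc j) * f (suc j))
    ≡⟨ cong₂ _+_ (ℤ.*-zeroˡ (f zero)) (∑-cong (λ j → cong (_* f (suc j)) (δ-suc i j))) ⟩
  0ℤ + ∑ (λ j → δ i j * f (suc j))  ≡⟨ ℤ.+-identityˡ _ ⟩
  ∑ (λ j → δ i j * f (suc j))       ≡⟨ ∑-δ i (f ∘ suc) ⟩
  f (suc i)                         ∎
  where
  δ-suc : ∀ {n} (i j : Fin n) → δ (suc i) (suc j) ≡ δ i j
  δ-suc i j with i ≟ j
  ... | yes _ = refl
  ... | no  _ = refl

-- Determinants

minor : ∀ {n} → Matrix (suc n) → Fin (suc n) → Matrix n
minor M j r c = M (suc r) (punchIn j c)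

laplaceTerm : ∀ {n} → Matrix (suc n) → Fin (suc n) → ℤ
laplaceTerm M j = sign (toℕ' j) * (M zero j * det (minor M j))

det-cong : ∀ {n} {A B : Matrix n} → (∀ i j → A i j ≡ B i j) → det A ≡ det B
det-cong {zero}  A≡B = refl
det-cong {suc n} A≡B = ∑-cong λ j →
  cong (sign (toℕ' j) *_) (cong₂ _*_ (A≡B zero j) (det-cong λ r c → A≡B (suc r) (punchIn j c)))

det-additive : ∀ {n} (A B C : Matrix n) (k : Fin n) →
  (∀ j → A k j ≡ B k j + C k j) →
  (∀ i → i ≢ k → ∀ j → A i j ≡ B i j × A i j ≡ C i j) →
  det A ≡ det B + det C
det-additive {suc n} A B C zero A≡B+C same = begin
  det A ≡⟨ ∑-cong term ⟩
  ∑ (λ j → laplaceTerm B j + laplaceTerm C j)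
    ≡⟨ ∑-distrib-+ (laplaceTerm B) (laplaceTerm C) ⟩
  det B + det C ∎
  where
  ring : ∀ s b c d → s * ((b + c) * d) ≡ s * (b * d) + s * (c * d)
  ring = solve-∀
  term : ∀ j → laplaceTerm A j ≡ laplaceTerm B j + laplaceTerm C j
  term j = begin
    sign (toℕ' j) * (A zero j * det (minor A j))
      ≡⟨ cong (λ a → sign (toℕ' j) * (a * det (minor A j))) (A≡B+C j) ⟩
    sign (toℕ' j) * ((B zero j + C zero j) * det (minor A j))
      ≡⟨ ring (sign (toℕ' j)) (B zero j) (C zero j) (det (minor A j)) ⟩
    sign (toℕ' j) * (B zero j * det (minor A j)) + sign (toℕ' j) * (C zero j * det (minor A j))
      ≡⟨ cong₂ (λ d e → sign (toℕ' j) * (B zero j * d) + sign (toℕ' j) * (C zero j * e))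
           (det-cong λ r c → proj₁ (same (suc r) (λ ()) (punchIn j c)))
           (det-cong λ r c → proj₂ (same (suc r) (λ ()) (punchIn j c))) ⟩
    sign (toℕ' j) * (B zero j * det (minor B j)) + sign (toℕ' j) * (C zero j * det (minor C j)) ∎
det-additive {suc n} A B C (suc k) A≡B+C same = begin
  det A ≡⟨ ∑-cong term ⟩
  ∑ (λ j → laplaceTerm B j + laplaceTerm C j)
    ≡⟨ ∑-distrib-+ (laplaceTerm B) (laplaceTerm C) ⟩
  det B + det C ∎
  where
  ring : ∀ s a d e → s * (a * (d + e)) ≡ s * (a * d) + s * (a * e)
  ring = solve-∀
  term : ∀ j → laplaceTerm A j ≡ laplaceTerm B j + laplaceTerm C j
  term j = begin
    sign (toℕ' j) * (A zero j * det (minor A j))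
      ≡⟨ cong (λ d → sign (toℕ' j) * (A zero j * d))
           (det-additive (minor A j) (minor B j) (minor C j) k (λ c → A≡B+C (punchIn j c))
             (λ i i≢k c → same (suc i) (i≢k ∘ suc-injective) (punchIn j c))) ⟩
    sign (toℕ' j) * (A zero j * (det (minor B j) + det (minor C j)))
      ≡⟨ ring (sign (toℕ' j)) (A zero j) (det (minor B j)) (det (minor C j)) ⟩
    sign (toℕ' j) * (A zero j * det (minor B j)) + sign (toℕ' j) * (A zero j * det (minor C j))
      ≡⟨ cong₂ (λ b c → sign (toℕ' j) * (b * det (minor B j)) + sign (toℕ' j) * (c * det (minor C j)))
           (proj₁ (same zero (λ ()) j)) (proj₂ (same zero (λ ()) j)) ⟩
    sign (toℕ' j) * (B zero j * det (minor B j)) + sign (toℕ' j) * (C zero j * det (minor C j)) ∎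

-- The two-row Laplace expansion with both rows equal to a: the terms for the ordered
-- pairs of columns (j , l) and (l , j) cancel.
∑∑-antisym : ∀ n (a : Fin (suc (suc n)) → ℤ) (d : (Fin n → Fin (suc (suc n))) → ℤ) →
  (∀ {e e'} → (∀ c → e c ≡ e' c) → d e ≡ d e') →
  ∑ (λ j → ∑ (λ k → (sign (toℕ' j) * sign (toℕ' k)) * ((a j * a (punchIn j k)) *
    d (λ c → punchIn j (punchIn k c))))) ≡ 0ℤ
∑∑-antisym n a d d-cong = begin
  -- Pairs that contain column 0 cancel among themselves. The others form the same sum with all
  -- columns shifted by one, which is why `d` is an arbitrary function of the embedding of the
  -- remaining columns.
  ∑ (λ k → F zero k) + ∑ (λ j → F (suc j) zero + ∑ (λ k → F (suc j) (suc k)))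
    ≡⟨ cong₂ _+_ (∑-cong λ k → swap (sign (toℕ' k)) (a zero) (a (suc k)) (d (λ c → suc (punchIn k c)))) (∑-distrib-+ (λ j → F (suc j) zero) (λ j → ∑ (λ k → F (suc j) (suc k)))) ⟩
  ∑ (λ k → -1ℤ * F (suc k) zero) + (∑ (λ j → F (suc j) zero) + ∑ (λ j → ∑ (λ k → F (suc j) (suc k))))
    ≡⟨ cong₂ (λ s t → s + (∑ (λ j → F (suc j) zero) + t)) (sym (*-distribˡ-∑ -1ℤ (λ j → F (suc j) zero))) (rest n a d d-cong) ⟩
  -1ℤ * ∑ (λ j → F (suc j) zero) + (∑ (λ j → F (suc j) zero) + 0ℤ)
    ≡⟨ cancel (∑ (λ j → F (suc j) zero)) ⟩
  0ℤ ∎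
  where
  F : Fin (suc (suc n)) → Fin (suc n) → ℤ
  F j k = (sign (toℕ' j) * sign (toℕ' k)) * ((a j * a (punchIn j k)) * d (λ c → punchIn j (punchIn k c)))
  swap : ∀ s a b d → (1ℤ * s) * ((a * b) * d) ≡ -1ℤ * ((- s * 1ℤ) * ((b * a) * d))
  swap = solve-∀
  cancel : ∀ s → -1ℤ * s + (s + 0ℤ) ≡ 0ℤ
  cancel = solve-∀
  signs : ∀ s t e → (- s * - t) * e ≡ (s * t) * e
  signs = solve-∀
  extend : ∀ {m n} → (Fin m → Fin n) → Fin (suc m) → Fin (suc n)
  extend e zero    = zero
  extend e (suc c) = suc (e c)
  extend-cong : ∀ {m n} {e e' : Fin m → Fin n} → (∀ c → e c ≡ e' c) → ∀ c → extend e c ≡ extend e' c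
  extend-cong e≡e' zero    = refl
  extend-cong e≡e' (suc c) = cong suc (e≡e' c)
  punchIn-extend : ∀ {n} (j : Fin (suc (suc n))) (k : Fin (suc n)) (c : Fin (suc n)) →
    punchIn (suc j) (punchIn (suc k) c) ≡ extend (λ c → punchIn j (punchIn k c)) c
  punchIn-extend j k zero    = refl
  punchIn-extend j k (suc c) = refl
  rest : ∀ n (a : Fin (suc (suc n)) → ℤ) (d : (Fin n → Fin (suc (suc n))) → ℤ) →
    (∀ {e e'} → (∀ c → e c ≡ e' c) → d e ≡ d e') →
    ∑ (λ j → ∑ (λ k → (- sign (toℕ' j) * - sign (toℕ' k)) * ((a (suc j) * a (suc (punchIn j k))) *
      d (λ c → punchIn (suc j) (punchIn (suc k) c))))) ≡ 0ℤ
  rest zero    a d d-cong = refl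
  rest (suc n) a d d-cong = trans
    (∑-cong λ j → ∑-cong λ k → trans (signs (sign (toℕ' j)) (sign (toℕ' k)) _)
      (cong (λ e → (sign (toℕ' j) * sign (toℕ' k)) * ((a (suc j) * a (suc (punchIn j k))) * e))
        (d-cong (punchIn-extend j k))))
    (∑∑-antisym n (a ∘ suc) (d ∘ extend) (λ e≡e' → d-cong (extend-cong e≡e')))

det-equal-first-rows : ∀ {n} (A : Matrix (suc (suc n))) → (∀ j → A zero j ≡ A (suc zero) j) → det A ≡ 0ℤ
det-equal-first-rows {n} A eq = begin
  det A ≡⟨ ∑-cong term ⟩
  ∑ (λ j → ∑ (λ k → (sign (toℕ' j) * sign (toℕ' k)) * ((A zero j * A zero (punchIn j k)) *
    d (λ c → punchIn j (punchIn k c)))))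
    ≡⟨ ∑∑-antisym n (A zero) d (λ e≡e' → det-cong λ r c → cong (A (suc (suc r))) (e≡e' c)) ⟩
  0ℤ ∎
  where
  d : (Fin n → Fin (suc (suc n))) → ℤ
  d e = det (λ r c → A (suc (suc r)) (e c))
  ring : ∀ s t a b d → (s * a) * (t * (b * d)) ≡ (s * t) * ((a * b) * d)
  ring = solve-∀
  term : ∀ j → sign (toℕ' j) * (A zero j * det (minor A j)) ≡
    ∑ (λ k → (sign (toℕ' j) * sign (toℕ' k)) * ((A zero j * A zero (punchIn j k)) *
      d (λ c → punchIn j (punchIn k c))))
  term j = begin
    sign (toℕ' j) * (A zero j * det (minor A j)) ≡⟨ ℤ.*-assoc (sign (toℕ' j)) (A zero j) _ ⟨
    (sign (toℕ' j) * A zero j) * det (minor A j) ≡⟨ *-distribˡ-∑ (sign (toℕ' j) * A zero j) (laplaceTerm (minor A j)) ⟩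
    ∑ (λ k → (sign (toℕ' j) * A zero j) * (sign (toℕ' k) * (A (suc zero) (punchIn j k) * d (λ c → punchIn j (punchIn k c)))))
      ≡⟨ (∑-cong λ k → trans
           (ring (sign (toℕ' j)) (sign (toℕ' k)) (A zero j) (A (suc zero) (punchIn j k)) _)
           (cong (λ b → (sign (toℕ' j) * sign (toℕ' k)) * ((A zero j * b) * d (λ c → punchIn j (punchIn k c))))
             (sym (eq (punchIn j k))))) ⟩
    ∑ (λ k → (sign (toℕ' j) * sign (toℕ' k)) * ((A zero j * A zero (punchIn j k)) *
      d (λ c → punchIn j (punchIn k c)))) ∎

-- Named as a property of the size because the proof is an induction on it: alternation for the
-- minors yields the sign of their row swaps, and these yield alternation one size up.
RowAlternating : ℕ → Set
RowAlternating n = ∀ (A : Matrix n) {i j} → i ≢ j → (∀ c → A i c ≡ A j c) → det A ≡ 0ℤ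

replaceRows : ∀ {n} {X : Set} → (Fin n → X) → Fin n → Fin n → (u v : X) → Fin n → X
replaceRows A i j u v = updateAt (updateAt A i (const u)) j (const v)

module _ {n} {X : Set} (A : Fin n → X) {i j : Fin n} (i≢j : i ≢ j) (u v : X) where
  replaceRows-first : replaceRows A i j u v i ≡ u
  replaceRows-first = trans (updateAt-minimal i j (updateAt A i (const u)) i≢j) (updateAt-updates i A)

  replaceRows-second : replaceRows A i j u v j ≡ v
  replaceRows-second = updateAt-updates j (updateAt A i (const u))

  replaceRows-other : ∀ k → k ≢ i → k ≢ j → replaceRows A i j u v k ≡ A k
  replaceRows-other k k≢i k≢j =
    trans (updateAt-minimal k j (updateAt A i (const u)) k≢j) (updateAt-minimal k i A k≢i)

-- Used with `f` deleting a column, to see that swapping two rows of a matrix swaps two rows of each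
-- minor.
map-replaceRows : ∀ {n} {X Y : Set} (f : X → Y) (A : Fin n → X) {i j} → i ≢ j → ∀ u v k →
  f (replaceRows A i j u v k) ≡ replaceRows (f ∘ A) i j (f u) (f v) k
map-replaceRows f A {i} {j} i≢j u v k with k ≟ i | k ≟ j
... | yes refl | _ = trans (cong f (replaceRows-first A i≢j u v)) (sym (replaceRows-first (f ∘ A) i≢j (f u) (f v)))
... | no _ | yes refl = trans (cong f (replaceRows-second A i≢j u v)) (sym (replaceRows-second (f ∘ A) i≢j (f u) (f v)))
... | no k≢i | no k≢j =
  trans (cong f (replaceRows-other A i≢j u v k k≢i k≢j)) (sym (replaceRows-other (f ∘ A) i≢j (f u) (f v) k k≢i k≢j))

-- Expand det with both rows i and j replaced by their sum.
det-swap-rows : ∀ {n} → RowAlternating n → ∀ (A : Matrix n) {i j} → i ≢ j →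
  det (replaceRows A i j (A j) (A i)) ≡ - det A
det-swap-rows {n} alternating A {i} {j} i≢j = begin
  det (R b a) ≡⟨ ring (det (R a b)) (det (R b a)) ⟩
  ((0ℤ + det (R a b)) + (det (R b a) + 0ℤ)) - det (R a b)
    ≡⟨ cong (_- det (R a b)) expand ⟨
  0ℤ - det (R a b) ≡⟨ ℤ.+-identityˡ _ ⟩
  - det (R a b) ≡⟨ cong -_ (det-cong unchanged) ⟩
  - det A ∎
  where
  R : (u v : Fin n → ℤ) → Matrix n
  R = replaceRows A i j
  a b a+b : Fin n → ℤ
  a = A i
  b = A j
  a+b c = a c + b c
  ring : ∀ s t → t ≡ ((0ℤ + s) + (t + 0ℤ)) - s
  ring = solve-∀
  vanish : ∀ u → det (R u u) ≡ 0ℤ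
  vanish u = alternating (R u u) i≢j λ c →
    cong (λ f → f c) (trans (replaceRows-first A i≢j u u) (sym (replaceRows-second A i≢j u u)))
  unchanged : ∀ k c → R a b k c ≡ A k c
  unchanged k c with k ≟ i | k ≟ j
  ... | yes refl | _ = cong (λ f → f c) (replaceRows-first A i≢j a b)
  ... | no _ | yes refl = cong (λ f → f c) (replaceRows-second A i≢j a b)
  ... | no k≢i | no k≢j = cong (λ f → f c) (replaceRows-other A i≢j a b k k≢i k≢j)
  additiveˡ : ∀ v → det (R a+b v) ≡ det (R a v) + det (R b v)
  additiveˡ v = det-additive (R a+b v) (R a v) (R b v) i
    (λ c → trans (cong (λ f → f c) (replaceRows-first A i≢j a+b v))
      (sym (cong₂ _+_ (cong (λ f → f c) (replaceRows-first A i≢j a v)) (cong (λ f → f c) (replaceRows-first A i≢j b v)))))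
    same
    where
    same : ∀ k → k ≢ i → ∀ c → R a+b v k c ≡ R a v k c × R a+b v k c ≡ R b v k c
    same k k≢i c with k ≟ j
    ... | yes refl = cong (λ f → f c) (trans (replaceRows-second A i≢j a+b v) (sym (replaceRows-second A i≢j a v)))
                   , cong (λ f → f c) (trans (replaceRows-second A i≢j a+b v) (sym (replaceRows-second A i≢j b v)))
    ... | no k≢j = cong (λ f → f c) (trans (replaceRows-other A i≢j a+b v k k≢i k≢j) (sym (replaceRows-other A i≢j a v k k≢i k≢j)))
                 , cong (λ f → f c) (trans (replaceRows-other A i≢j a+b v k k≢i k≢j) (sym (replaceRows-other A i≢j b v k k≢i k≢j)))
  additiveʳ : ∀ u → det (R u a+b) ≡ det (R u a) + det (R u b)
  additiveʳ u = det-additive (R u a+b) (R u a) (R u b) j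
    (λ c → trans (cong (λ f → f c) (replaceRows-second A i≢j u a+b))
      (sym (cong₂ _+_ (cong (λ f → f c) (replaceRows-second A i≢j u a)) (cong (λ f → f c) (replaceRows-second A i≢j u b)))))
    λ k k≢j c → cong (λ f → f c) (same k k≢j a+b a) , cong (λ f → f c) (same k k≢j a+b b)
    where
    same : ∀ k → k ≢ j → ∀ v w → R u v k ≡ R u w k
    same k k≢j v w = trans (updateAt-minimal k j (updateAt A i (const u)) k≢j)
      (sym (updateAt-minimal k j (updateAt A i (const u)) k≢j))
  expand : 0ℤ ≡ (0ℤ + det (R a b)) + (det (R b a) + 0ℤ)
  expand = begin
    0ℤ ≡⟨ vanish a+b ⟨
    det (R a+b a+b) ≡⟨ additiveˡ a+b ⟩
    det (R a a+b) + det (R b a+b) ≡⟨ cong₂ _+_ (additiveʳ a) (additiveʳ b) ⟩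
    (det (R a a) + det (R a b)) + (det (R b a) + det (R b b))
      ≡⟨ cong₂ (λ s t → (s + det (R a b)) + (det (R b a) + t)) (vanish a) (vanish b) ⟩
    (0ℤ + det (R a b)) + (det (R b a) + 0ℤ) ∎

det-alternating-zero : ∀ {n} → RowAlternating n → (A : Matrix (suc n)) (j : Fin n) →
  (∀ c → A zero c ≡ A (suc j) c) → det A ≡ 0ℤ
det-alternating-zero {suc n} alternating A zero    eq = det-equal-first-rows A eq
-- Swapping rows 1 and j + 2, i.e. rows 0 and j + 1 of every minor along row 0, makes
-- the first two rows equal.
det-alternating-zero {suc n} alternating A (suc j) eq = begin
  det A ≡⟨ ℤ.neg-involutive (det A) ⟨
  - - det A ≡⟨ cong -_ negated ⟨
  - det A' ≡⟨ cong -_ (det-equal-first-rows A' λ c → trans (eq c)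
    (sym (cong (λ f → f c) (replaceRows-first (A ∘ suc) 0≢suc-j (A (suc (suc j))) (A (suc zero)))))) ⟩
  0ℤ ∎
  where
  0≢suc-j : zero ≢ suc j
  0≢suc-j ()
  A' : Matrix (suc (suc n))
  A' zero    = A zero
  A' (suc r) = replaceRows (A ∘ suc) zero (suc j) (A (suc (suc j))) (A (suc zero)) r
  minors : ∀ k → det (minor A' k) ≡ - det (minor A k)
  minors k = trans
    (det-cong λ r c → cong (λ f → f c)
      (map-replaceRows (_∘ punchIn k) (A ∘ suc) 0≢suc-j (A (suc (suc j))) (A (suc zero)) r))
    (det-swap-rows alternating (minor A k) 0≢suc-j)
  ring : ∀ s a d → s * (a * - d) ≡ -1ℤ * (s * (a * d))
  ring = solve-∀
  negated : det A' ≡ - det A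
  negated = begin
    det A' ≡⟨ ∑-cong (λ k → trans (cong (λ d → sign (toℕ' k) * (A zero k * d)) (minors k))
                (ring (sign (toℕ' k)) (A zero k) (det (minor A k)))) ⟩
    ∑ (λ k → -1ℤ * laplaceTerm A k) ≡⟨ *-distribˡ-∑ -1ℤ (laplaceTerm A) ⟨
    -1ℤ * det A ≡⟨ ℤ.-1*i≡-i (det A) ⟩
    - det A ∎

det-alternating : ∀ n → RowAlternating n
det-alternating (suc n) A {zero}  {zero}  i≢j eq = contradiction refl i≢j
det-alternating (suc n) A {zero}  {suc j} i≢j eq = det-alternating-zero (det-alternating n) A j eq
det-alternating (suc n) A {suc i} {zero}  i≢j eq = det-alternating-zero (det-alternating n) A i (sym ∘ eq)
det-alternating (suc n) A {suc i} {suc j} i≢j eq = ∑-zero λ k → begin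
  sign (toℕ' k) * (A zero k * det (minor A k))
    ≡⟨ cong (λ d → sign (toℕ' k) * (A zero k * d))
         (det-alternating n (minor A k) (i≢j ∘ cong suc) (λ c → eq (punchIn k c))) ⟩
  sign (toℕ' k) * (A zero k * 0ℤ) ≡⟨ ring (sign (toℕ' k)) (A zero k) ⟩
  0ℤ ∎
  where
  ring : ∀ s a → s * (a * 0ℤ) ≡ 0ℤ
  ring = solve-∀

-- Adjugates and Cramer's rule

Adjugate : ∀ {n} → Matrix n → Fin n → Set
Adjugate {n} A k = Σ (Fin n → ℤ) λ z → ∀ i → ∑ (λ j → A i j * z j) ≡ det A * δ i k

-- The solution consists of the cofactors of row 0. Against row 0 they give the Laplace expansion;
-- against a later row they give the determinant of a matrix in which that row occurs twice.
adjugate-zero : ∀ {n} (A : Matrix (suc n)) → Adjugate A zero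
adjugate-zero {n} A = z , solves
  where
  z : Fin (suc n) → ℤ
  z j = sign (toℕ' j) * det (minor A j)
  ring : ∀ a s d → a * (s * d) ≡ s * (a * d)
  ring = solve-∀
  solves : ∀ i → ∑ (λ j → A i j * z j) ≡ det A * δ i zero
  solves zero = begin
    ∑ (λ j → A zero j * z j) ≡⟨ ∑-cong (λ j → ring (A zero j) (sign (toℕ' j)) (det (minor A j))) ⟩
    det A      ≡⟨ ℤ.*-identityʳ (det A) ⟨
    det A * 1ℤ ∎
  solves (suc i) = begin
    ∑ (λ j → A (suc i) j * z j) ≡⟨ ∑-cong (λ j → ring (A (suc i) j) (sign (toℕ' j)) (det (minor A j))) ⟩
    det A' ≡⟨ det-alternating (suc n) A' {zero} {suc i} (λ ()) (λ c → refl) ⟩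
    0ℤ         ≡⟨ ℤ.*-zeroʳ (det A) ⟨
    det A * 0ℤ ∎
    where
    A' : Matrix (suc n)
    A' zero    = A (suc i)
    A' (suc r) = A (suc r)

δ-refl : ∀ {n} (i : Fin n) → δ i i ≡ 1ℤ
δ-refl i with i ≟ i
... | yes _ = refl
... | no i≢i = contradiction refl i≢i

δ-≢ : ∀ {n} {i j : Fin n} → i ≢ j → δ i j ≡ 0ℤ
δ-≢ {i = i} {j} i≢j with i ≟ j
... | yes i≡j = contradiction i≡j i≢j
... | no _ = refl

-- Only the expansion along row 0 is available, so row k is first swapped with row 0. The swap
-- changes the sign of the determinant, which the sign in - z compensates.
adjugate : ∀ {n} (A : Matrix n) k → Adjugate A k
adjugate {suc n} A zero = adjugate-zero A
adjugate {suc n} A (suc k) = (λ j → - z j) , solves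
  where
  0≢suc-k : zero ≢ suc k
  0≢suc-k ()
  A' : Matrix (suc n)
  A' = replaceRows A zero (suc k) (A (suc k)) (A zero)
  z : Fin (suc n) → ℤ
  z = proj₁ (adjugate-zero A')
  ring : ∀ a z → a * - z ≡ -1ℤ * (a * z)
  ring = solve-∀
  negate : ∀ d e → -1ℤ * (- d * e) ≡ d * e
  negate = solve-∀
  row : ∀ i r → A i ≡ A' r → ∑ (λ j → A i j * - z j) ≡ det A * δ r zero
  row i r eq = begin
    ∑ (λ j → A i j * - z j)          ≡⟨ ∑-cong (λ j → trans (cong (λ f → f j * - z j) eq) (ring (A' r j) (z j))) ⟩
    ∑ (λ j → -1ℤ * (A' r j * z j))   ≡⟨ *-distribˡ-∑ -1ℤ (λ j → A' r j * z j) ⟨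
    -1ℤ * ∑ (λ j → A' r j * z j)     ≡⟨ cong (-1ℤ *_) (proj₂ (adjugate-zero A') r) ⟩
    -1ℤ * (det A' * δ r zero)        ≡⟨ cong (λ d → -1ℤ * (d * δ r zero)) (det-swap-rows (det-alternating (suc n)) A 0≢suc-k) ⟩
    -1ℤ * (- det A * δ r zero)       ≡⟨ negate (det A) (δ r zero) ⟩
    det A * δ r zero                 ∎
  cases : ∀ i → Dec (i ≡ zero) → Dec (i ≡ suc k) → ∑ (λ j → A i j * - z j) ≡ det A * δ i (suc k)
  cases i (yes refl) _ = row zero (suc k) (sym (replaceRows-second A 0≢suc-k (A (suc k)) (A zero)))
  cases i (no _) (yes refl) = trans
    (row (suc k) zero (sym (replaceRows-first A 0≢suc-k (A (suc k)) (A zero))))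
    (cong (det A *_) (sym (δ-refl (suc k))))
  cases i (no i≢0) (no i≢suc-k) = trans
    (row i i (sym (replaceRows-other A 0≢suc-k (A (suc k)) (A zero) i i≢0 i≢suc-k)))
    (cong (det A *_) (trans (δ-≢ i≢0) (sym (δ-≢ i≢suc-k))))
  solves : ∀ i → ∑ (λ j → A i j * - z j) ≡ det A * δ i (suc k)
  solves i = cases i (i ≟ zero) (i ≟ suc k)

-- The solution is the adjugate applied to `v`. The factor `det A` stays on the right instead of
-- being divided out, which keeps the solution integral.
cramer : ∀ {n} (A : Matrix n) (v : Fin n → ℤ) →
  Σ (Fin n → ℤ) λ z → ∀ i → ∑ (λ j → A i j * z j) ≡ det A * v i
cramer {n} A v = z , λ i → begin
  ∑ (λ j → A i j * z j)
    ≡⟨ ∑-cong (λ j → *-distribˡ-∑ (A i j) (λ k → v k * y k j)) ⟩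
  ∑ (λ j → ∑ (λ k → A i j * (v k * y k j)))
    ≡⟨ ∑-comm (λ j k → A i j * (v k * y k j)) ⟩
  ∑ (λ k → ∑ (λ j → A i j * (v k * y k j)))
    ≡⟨ ∑-cong (λ k → trans (∑-cong (λ j → ring (A i j) (v k) (y k j))) (sym (*-distribˡ-∑ (v k) (λ j → A i j * y k j)))) ⟩
  ∑ (λ k → v k * ∑ (λ j → A i j * y k j))
    ≡⟨ ∑-cong (λ k → trans (cong (v k *_) (proj₂ (adjugate A k) i)) (ring' (v k) (det A) (δ i k))) ⟩
  ∑ (λ k → det A * (δ i k * v k))
    ≡⟨ *-distribˡ-∑ (det A) (λ k → δ i k * v k) ⟨
  det A * ∑ (λ k → δ i k * v k)
    ≡⟨ cong (det A *_) (∑-δ i v) ⟩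
  det A * v i ∎
  where
  y : Fin n → Fin n → ℤ
  y k = proj₁ (adjugate A k)
  z : Fin n → ℤ
  z j = ∑ (λ k → v k * y k j)
  ring : ∀ a v y → a * (v * y) ≡ v * (a * y)
  ring = solve-∀
  ring' : ∀ v d e → v * (d * e) ≡ d * (e * v)
  ring' = solve-∀

-- Matrices as operators

op : ∀ {n} → Matrix n → (Fin n → ℤ) → Fin n → ℤ
op M v i = ∑ (λ j → M i j * v j)

module _ {n} (M : Matrix n) where
  op-cong : ∀ {v w : Fin n → ℤ} → (∀ i → v i ≡ w i) → ∀ i → op M v i ≡ op M w i
  op-cong v≡w i = ∑-cong λ j → cong (M i j *_) (v≡w j)

  op-linear : ∀ a b (v w : Fin n → ℤ) i → op M (λ j → a * v j + b * w j) i ≡ a * op M v i + b * op M w i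
  op-linear a b v w i = begin
    ∑ (λ j → M i j * (a * v j + b * w j)) ≡⟨ ∑-cong (λ j → ring (M i j) a b (v j) (w j)) ⟩
    ∑ (λ j → a * (M i j * v j) + b * (M i j * w j)) ≡⟨ ∑-distrib-+ (λ j → a * (M i j * v j)) (λ j → b * (M i j * w j)) ⟩
    ∑ (λ j → a * (M i j * v j)) + ∑ (λ j → b * (M i j * w j))
      ≡⟨ cong₂ _+_ (*-distribˡ-∑ a (λ j → M i j * v j)) (*-distribˡ-∑ b (λ j → M i j * w j)) ⟨
    a * op M v i + b * op M w i ∎
    where
    ring : ∀ m a b v w → m * (a * v + b * w) ≡ a * (m * v) + b * (m * w)
    ring = solve-∀

  shifted : ℤ → (Fin n → ℤ) → Fin n → ℤ
  shifted x v i = x * v i - op M v i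

  op-shifted : ∀ x (v : Fin n → ℤ) i → ∑ (λ j → (x * δ i j - M i j) * v j) ≡ shifted x v i
  op-shifted x v i = begin
    ∑ (λ j → (x * δ i j - M i j) * v j)
      ≡⟨ ∑-cong (λ j → ring x (δ i j) (M i j) (v j)) ⟩
    ∑ (λ j → x * (δ i j * v j) + -1ℤ * (M i j * v j))
      ≡⟨ ∑-distrib-+ (λ j → x * (δ i j * v j)) (λ j → -1ℤ * (M i j * v j)) ⟩
    ∑ (λ j → x * (δ i j * v j)) + ∑ (λ j → -1ℤ * (M i j * v j))
      ≡⟨ cong₂ _+_ (*-distribˡ-∑ x (λ j → δ i j * v j)) (*-distribˡ-∑ -1ℤ (λ j → M i j * v j)) ⟨
    x * ∑ (λ j → δ i j * v j) + -1ℤ * op M v i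
      ≡⟨ cong₂ (λ s t → x * s + t) (∑-δ i v) (ℤ.-1*i≡-i (op M v i)) ⟩
    x * v i - op M v i ∎
    where
    ring : ∀ x d m v → (x * d - m) * v ≡ x * (d * v) + -1ℤ * (m * v)
    ring = solve-∀

  applyRoots : ∀ {m} → (Fin m → ℤ) → (Fin n → ℤ) → Fin n → ℤ
  applyRoots {zero}  λs v = v
  applyRoots {suc m} λs v = applyRoots (λs ∘ suc) (λ i → op M v i - λs zero * v i)

  -- For a polynomial p, p(x) - p(M) is divisible by x - M; here p = ∏ᵢ (x - λᵢ).
  applyRoots-divides : ∀ {m} (λs : Fin m → ℤ) x v →
    Σ (Fin n → ℤ) λ w → ∀ i → shifted x w i ≡ ∏ (λ k → x - λs k) * v i - applyRoots λs v i
  applyRoots-divides {zero} λs x v = (λ _ → 0ℤ) , λ i →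
    trans (cong (λ s → x * 0ℤ - s) (∑-zero λ j → ℤ.*-zeroʳ (M i j))) (ring x (v i))
    where
    ring : ∀ x v → x * 0ℤ - 0ℤ ≡ 1ℤ * v - v
    ring = solve-∀
  -- With P the product of the remaining factors, (x - l) P(x) - P(M) (M - l) = P(x) (x - M) + (P(x)
  -- - P(M)) (M - l). The first summand contributes `p * v`, the second the induction hypothesis at
  -- (M - l) v. The coefficient `1ℤ` only gives the sum the shape that `op-linear` expects.
  applyRoots-divides {suc m} λs x v = (λ i → p * v i + 1ℤ * w i) , λ i → begin
    x * (p * v i + 1ℤ * w i) - op M (λ i → p * v i + 1ℤ * w i) i
      ≡⟨ cong (λ s → x * (p * v i + 1ℤ * w i) - s) (op-linear p 1ℤ v w i) ⟩
    x * (p * v i + 1ℤ * w i) - (p * op M v i + 1ℤ * op M w i)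
      ≡⟨ ring x p (v i) (w i) (op M v i) (op M w i) ⟩
    (x * w i - op M w i) + p * (x * v i - op M v i)
      ≡⟨ cong (_+ p * (x * v i - op M v i)) (proj₂ IH i) ⟩
    (p * (op M v i - l * v i) - applyRoots λs v i) + p * (x * v i - op M v i)
      ≡⟨ ring' x l p (v i) (op M v i) (applyRoots λs v i) ⟩
    ((x - l) * p) * v i - applyRoots λs v i ∎
    where
    l p : ℤ
    l = λs zero
    p = ∏ (λ k → x - λs (suc k))
    IH = applyRoots-divides (λs ∘ suc) x (λ i → op M v i - l * v i)
    w : Fin n → ℤ
    w = proj₁ IH
    ring : ∀ x p v w mv mw →
      x * (p * v + 1ℤ * w) - (p * mv + 1ℤ * mw) ≡ (x * w - mw) + p * (x * v - mv)
    ring = solve-∀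
    ring' : ∀ x l p v mv r → (p * (mv - l * v) - r) + p * (x * v - mv) ≡ ((x - l) * p) * v - r
    ring' = solve-∀

-- The ℓ¹ norm and the Cayley-Hamilton theorem

‖_‖ : ∀ {n} → (Fin n → ℤ) → ℕ
‖ v ‖ = ℕSum.sum (λ i → ∣ v i ∣)

sum-mono : ∀ {n} {f g : Fin n → ℕ} → (∀ i → f i ℕ.≤ g i) → ℕSum.sum f ℕ.≤ ℕSum.sum g
sum-mono {zero}  f≤g = ℕ.z≤n
sum-mono {suc n} f≤g = ℕ.+-mono-≤ (f≤g zero) (sum-mono (f≤g ∘ suc))

term≤sum : ∀ {n} (f : Fin n → ℕ) i → f i ℕ.≤ ℕSum.sum f
term≤sum f zero    = ℕ.m≤m+n (f zero) _
term≤sum f (suc i) = ℕ.≤-trans (term≤sum (f ∘ suc) i) (ℕ.m≤n+m _ (f zero))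

∣∑∣≤sum : ∀ {n} (f : Fin n → ℤ) → ∣ ∑ f ∣ ℕ.≤ ‖ f ‖
∣∑∣≤sum {zero}  f = ℕ.z≤n
∣∑∣≤sum {suc n} f = ℕ.≤-trans (ℤ.∣i+j∣≤∣i∣+∣j∣ (f zero) (∑ (f ∘ suc))) (ℕ.+-monoʳ-≤ ∣ f zero ∣ (∣∑∣≤sum (f ∘ suc)))

‖v‖≡0⇒v≡0 : ∀ {n} (v : Fin n → ℤ) → ‖ v ‖ ≡ 0 → ∀ i → v i ≡ 0ℤ
‖v‖≡0⇒v≡0 v eq i = ℤ.∣i∣≡0⇒i≡0 (ℕ.n≤0⇒n≡0 (subst (∣ v i ∣ ℕ.≤_) eq (term≤sum (λ i → ∣ v i ∣) i)))

op-bounded : ∀ {n} (M : Matrix n) v → ‖ op M v ‖ ℕ.≤ ℕSum.sum (λ i → ‖ M i ‖) ℕ.* ‖ v ‖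
op-bounded M v = subst (‖ op M v ‖ ℕ.≤_) (sym (ℕSum.*-distribʳ-sum ‖ v ‖ (λ i → ‖ M i ‖))) (sum-mono row)
  where
  entry : ∀ i j → ∣ M i j * v j ∣ ℕ.≤ ∣ M i j ∣ ℕ.* ‖ v ‖
  entry i j = subst (ℕ._≤ ∣ M i j ∣ ℕ.* ‖ v ‖) (sym (ℤ.abs-* (M i j) (v j)))
    (ℕ.*-monoʳ-≤ ∣ M i j ∣ (term≤sum (λ i → ∣ v i ∣) j))
  row : ∀ i → ∣ op M v i ∣ ℕ.≤ ‖ M i ‖ ℕ.* ‖ v ‖
  row i = ℕ.≤-trans (∣∑∣≤sum (λ j → M i j * v j))
    (subst (‖ (λ j → M i j * v j) ‖ ℕ.≤_) (sym (ℕSum.*-distribʳ-sum ‖ v ‖ (λ j → ∣ M i j ∣))) (sum-mono (entry i)))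

-- For x > ‖M‖ + ‖u‖ the only possible integral solution of (x - M) y = u is y = 0.
solvable⇒zero : ∀ {n} (M : Matrix n) (u : Fin n → ℤ) →
  (∀ x → Σ (Fin n → ℤ) λ y → ∀ i → shifted M x y i ≡ u i) → ∀ i → u i ≡ 0ℤ
solvable⇒zero {n} M u solve i = begin
  u i                  ≡⟨ proj₂ (solve x) i ⟨
  x * y i - op M y i   ≡⟨ cong₂ (λ s t → x * s - t) (y≡0 i) (trans (op-cong M y≡0 i) (∑-zero λ j → ℤ.*-zeroʳ (M i j))) ⟩
  x * 0ℤ - 0ℤ          ≡⟨ cong (_- 0ℤ) (ℤ.*-zeroʳ x) ⟩
  0ℤ                   ∎
  where
  K X : ℕ
  K = ℕSum.sum (λ i → ‖ M i ‖)
  X = suc (‖ u ‖ ℕ.+ K)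
  x : ℤ
  x = pos X
  y : Fin n → ℤ
  y = proj₁ (solve x)
  row : ∀ i → X ℕ.* ∣ y i ∣ ℕ.≤ ∣ u i ∣ ℕ.+ ∣ op M y i ∣
  row i = subst (ℕ._≤ ∣ u i ∣ ℕ.+ ∣ op M y i ∣)
    (trans (cong ∣_∣ (trans (cong (_+ op M y i) (sym (proj₂ (solve x) i))) (ring (x * y i) (op M y i)))) (ℤ.abs-* x (y i)))
    (ℤ.∣i+j∣≤∣i∣+∣j∣ (u i) (op M y i))
    where
    ring : ∀ s t → (s - t) + t ≡ s
    ring = solve-∀
  bound : X ℕ.* ‖ y ‖ ℕ.≤ ‖ u ‖ ℕ.+ K ℕ.* ‖ y ‖
  bound = subst (ℕ._≤ ‖ u ‖ ℕ.+ K ℕ.* ‖ y ‖) (sym (ℕSum.*-distribˡ-sum X (λ i → ∣ y i ∣)))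
    (ℕ.≤-trans (sum-mono row)
      (subst (ℕ._≤ ‖ u ‖ ℕ.+ K ℕ.* ‖ y ‖) (sym (ℕSum.∑-distrib-+ (λ i → ∣ u i ∣) (λ i → ∣ op M y i ∣)))
        (ℕ.+-monoʳ-≤ ‖ u ‖ (op-bounded M y))))
  -- Integrality of `y` enters here: its norm is a natural number, and a norm of at least 1 would
  -- make the left side exceed the right.
  small : ∀ U Y → suc (U ℕ.+ K) ℕ.* Y ℕ.≤ U ℕ.+ K ℕ.* Y → Y ≡ 0
  small U zero    _ = refl
  small U (suc Y) p = contradiction p (ℕ.<⇒≱ (ℕ.s≤s (ℕ.≤-trans
    (ℕ.+-monoˡ-≤ (K ℕ.* suc Y) (ℕ.m≤m*n U (suc Y)))
    (ℕ.≤-trans (ℕ.≤-reflexive (sym (ℕ.*-distribʳ-+ (suc Y) U K))) (ℕ.m≤n+m _ Y)))))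
  y≡0 : ∀ i → y i ≡ 0ℤ
  y≡0 = ‖v‖≡0⇒v≡0 y (small ‖ u ‖ ‖ y ‖ bound)

-- Let p be the characteristic polynomial. Cramer's rule gives z with (x - M) z = p(x) v, and
-- division gives w with (x - M) w = p(x) v - p(M) v. So z - w solves (x - M) y = p(M) v for every
-- integer x, while the right side does not depend on x.
cayley-hamilton : ∀ {n} (M : Matrix n) (integral : AllEigenvaluesIntegral M) v i →
  applyRoots M (proj₁ integral) v i ≡ 0ℤ
cayley-hamilton {n} M (λs , split) v = solvable⇒zero M (applyRoots M λs v) solve
  where
  solve : ∀ x → Σ (Fin n → ℤ) λ y → ∀ i → shifted M x y i ≡ applyRoots M λs v i
  solve x = (λ i → 1ℤ * z i + -1ℤ * w i) , λ i → begin
    x * (1ℤ * z i + -1ℤ * w i) - op M (λ i → 1ℤ * z i + -1ℤ * w i) i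
      ≡⟨ cong (λ s → x * (1ℤ * z i + -1ℤ * w i) - s) (op-linear M 1ℤ -1ℤ z w i) ⟩
    x * (1ℤ * z i + -1ℤ * w i) - (1ℤ * op M z i + -1ℤ * op M w i)
      ≡⟨ ring x (z i) (w i) (op M z i) (op M w i) ⟩
    (x * z i - op M z i) - (x * w i - op M w i)
      ≡⟨ cong₂ _-_ (trans (sym (op-shifted M x z i)) (trans (proj₂ z-solves i) (cong (_* v i) (split x))))
                   (proj₂ w-solves i) ⟩
    p * v i - (p * v i - applyRoots M λs v i)
      ≡⟨ ring' (p * v i) (applyRoots M λs v i) ⟩
    applyRoots M λs v i ∎
    where
    p = ∏ (λ k → x - λs k)
    z-solves = cramer (λ i j → x * δ i j - M i j) v
    w-solves = applyRoots-divides M λs x v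
    z w : Fin n → ℤ
    z = proj₁ z-solves
    w = proj₁ w-solves
    ring : ∀ x z w mz mw →
      x * (1ℤ * z + -1ℤ * w) - (1ℤ * mz + -1ℤ * mw) ≡ (x * z - mz) - (x * w - mw)
    ring = solve-∀
    ring' : ∀ s t → s - (s - t) ≡ t
    ring' = solve-∀

-- Peel off the factors of ∏ᵢ (M - λᵢ) v = 0 one at a time.
no-eigenvector⇒zero : ∀ {n} (M : Matrix n) → AllEigenvaluesIntegral M → (Q : (Fin n → ℤ) → Set) →
  (∀ l v → Q v → Q (λ i → op M v i - l * v i)) →
  (∀ l v → Q v → (∀ i → op M v i ≡ l * v i) → ∀ i → v i ≡ 0ℤ) →
  ∀ v → Q v → ∀ i → v i ≡ 0ℤ
no-eigenvector⇒zero {n} M integral Q invariant eigen v q = peel (proj₁ integral) v q (cayley-hamilton M integral v)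
  where
  peel : ∀ {m} (λs : Fin m → ℤ) v → Q v → (∀ i → applyRoots M λs v i ≡ 0ℤ) → ∀ i → v i ≡ 0ℤ
  peel {zero}  λs v q p≡0 = p≡0
  -- The induction hypothesis applies to (M - λ₀) v, which still satisfies `Q`. Once that vector
  -- vanishes, `v` itself is an eigenvector for λ₀.
  peel {suc m} λs v q p≡0 = eigen (λs zero) v q λ i → ℤ.i-j≡0⇒i≡j (op M v i) (λs zero * v i)
    (peel (λs ∘ suc) (λ i → op M v i - λs zero * v i) (invariant (λs zero) v q) p≡0 i)

-- Spectral consequences of integrality

⟨_,_⟩ : ∀ {n} → (Fin n → ℤ) → (Fin n → ℤ) → ℤ
⟨ v , w ⟩ = ∑ (λ i → v i * w i)

Symmetric : ∀ {n} → Matrix n → Set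
Symmetric M = ∀ i j → M i j ≡ M j i

⟨⟩-linearˡ : ∀ {n} a b (u v w : Fin n → ℤ) → ⟨ (λ i → a * u i + b * v i) , w ⟩ ≡ a * ⟨ u , w ⟩ + b * ⟨ v , w ⟩
⟨⟩-linearˡ a b u v w = begin
  ∑ (λ i → (a * u i + b * v i) * w i) ≡⟨ ∑-cong (λ i → ring a b (u i) (v i) (w i)) ⟩
  ∑ (λ i → a * (u i * w i) + b * (v i * w i)) ≡⟨ ∑-distrib-+ (λ i → a * (u i * w i)) (λ i → b * (v i * w i)) ⟩
  ∑ (λ i → a * (u i * w i)) + ∑ (λ i → b * (v i * w i))
    ≡⟨ cong₂ _+_ (*-distribˡ-∑ a (λ i → u i * w i)) (*-distribˡ-∑ b (λ i → v i * w i)) ⟨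
  a * ⟨ u , w ⟩ + b * ⟨ v , w ⟩ ∎
  where
  ring : ∀ a b u v w → (a * u + b * v) * w ≡ a * (u * w) + b * (v * w)
  ring = solve-∀

op-self-adjoint : ∀ {n} (M : Matrix n) → Symmetric M → ∀ v w → ⟨ op M v , w ⟩ ≡ ⟨ v , op M w ⟩
op-self-adjoint M symmetric v w = begin
  ∑ (λ i → op M v i * w i)
    ≡⟨ ∑-cong (λ i → trans (ℤ.*-comm (op M v i) (w i)) (*-distribˡ-∑ (w i) (λ j → M i j * v j))) ⟩
  ∑ (λ i → ∑ (λ j → w i * (M i j * v j))) ≡⟨ ∑-comm (λ i j → w i * (M i j * v j)) ⟩
  ∑ (λ j → ∑ (λ i → w i * (M i j * v j)))
    ≡⟨ ∑-cong (λ j → trans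
         (∑-cong λ i → trans (cong (λ m → w i * (m * v j)) (symmetric i j)) (ring (w i) (M j i) (v j)))
         (sym (*-distribˡ-∑ (v j) (λ i → M j i * w i)))) ⟩
  ∑ (λ j → v j * op M w j) ∎
  where
  ring : ∀ w m v → w * (m * v) ≡ v * (m * w)
  ring = solve-∀

⟨v,v⟩≡0⇒v≡0 : ∀ {n} (v : Fin n → ℤ) → ⟨ v , v ⟩ ≡ 0ℤ → ∀ i → v i ≡ 0ℤ
⟨v,v⟩≡0⇒v≡0 v eq i = [ id , id ]′ (ℤ.i*j≡0⇒i≡0∨j≡0 (v i) square≡0)
  where
  square : ∀ x → x * x ≡ pos (∣ x ∣ ℕ.* ∣ x ∣)
  square (pos x)   = sym (ℤ.pos-* x x)
  square -[1+ x ]  = refl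
  ∑-pos : ∀ {n} (f : Fin n → ℕ) → ∑ (λ i → pos (f i)) ≡ pos (ℕSum.sum f)
  ∑-pos {zero}  f = refl
  ∑-pos {suc n} f = cong (pos (f zero) +_) (∑-pos (f ∘ suc))
  squares : Fin _ → ℕ
  squares i = ∣ v i ∣ ℕ.* ∣ v i ∣
  sum≡0 : ℕSum.sum squares ≡ 0
  sum≡0 = ℤ.+-injective (trans (sym (∑-pos squares)) (trans (∑-cong (λ i → sym (square (v i)))) eq))
  square≡0 : v i * v i ≡ 0ℤ
  square≡0 = trans (square (v i))
    (cong pos (ℕ.n≤0⇒n≡0 (subst (squares i ℕ.≤_) sum≡0 (term≤sum squares i))))

module _ {n} (M : Matrix n) where
  op^ : ℕ → (Fin n → ℤ) → Fin n → ℤ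
  op^ zero    v = v
  op^ (suc k) v = op M (op^ k v)

  op^-linear : ∀ k a b v w i → op^ k (λ j → a * v j + b * w j) i ≡ a * op^ k v i + b * op^ k w i
  op^-linear zero    a b v w i = refl
  op^-linear (suc k) a b v w i =
    trans (op-cong M (op^-linear k a b v w) i) (op-linear M a b (op^ k v) (op^ k w) i)

  op^-op : ∀ k v i → op^ k (op M v) i ≡ op M (op^ k v) i
  op^-op zero    v i = refl
  op^-op (suc k) v i = op-cong M (op^-op k v) i

  -- 3 is not a square.
  op²≡3⇒zero : AllEigenvaluesIntegral M → ∀ v → (∀ i → op^ 2 v i ≡ pos 3 * v i) → ∀ i → v i ≡ 0ℤ
  op²≡3⇒zero integral = no-eigenvector⇒zero M integral (λ v → ∀ i → op^ 2 v i ≡ pos 3 * v i) invariant eigen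
    where
    rearrange : ∀ l v w → w - l * v ≡ 1ℤ * w + - l * v
    rearrange = solve-∀
    invariant : ∀ l v → (∀ i → op^ 2 v i ≡ pos 3 * v i) → ∀ i →
      op^ 2 (λ i → op M v i - l * v i) i ≡ pos 3 * (op M v i - l * v i)
    invariant l v q i = begin
      op^ 2 (λ i → op M v i - l * v i) i
        ≡⟨ op-cong M (op-cong M (λ j → rearrange l (v j) (op M v j))) i ⟩
      op^ 2 (λ i → 1ℤ * op M v i + - l * v i) i
        ≡⟨ op^-linear 2 1ℤ (- l) (op M v) v i ⟩
      1ℤ * op M (op^ 2 v) i + - l * op^ 2 v i
        ≡⟨ cong₂ (λ s t → 1ℤ * s + - l * t)
             (trans (op-cong M (λ j → trans (q j) (sym (ℤ.+-identityʳ _))) i) (op-linear M (pos 3) 0ℤ v v i)) (q i) ⟩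
      1ℤ * (pos 3 * op M v i + 0ℤ * op M v i) + - l * (pos 3 * v i)
        ≡⟨ ring l (v i) (op M v i) ⟩
      pos 3 * (op M v i - l * v i) ∎
      where
      ring : ∀ l v w → 1ℤ * (pos 3 * w + 0ℤ * w) + - l * (pos 3 * v) ≡ pos 3 * (w - l * v)
      ring = solve-∀
    m²≢3 : ∀ m → m ℕ.* m ≢ 3
    m²≢3 (suc (suc m)) eq = contradiction
      (subst (4 ℕ.≤_) eq (ℕ.*-mono-≤ {2} {suc (suc m)} (ℕ.s≤s (ℕ.s≤s ℕ.z≤n)) (ℕ.s≤s (ℕ.s≤s ℕ.z≤n))))
      λ { (ℕ.s≤s (ℕ.s≤s (ℕ.s≤s ()))) }
    l²≢3 : ∀ l → l * l - pos 3 ≢ 0ℤ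
    l²≢3 l eq = m²≢3 ∣ l ∣ (trans (sym (ℤ.abs-* l l)) (cong ∣_∣ (ℤ.i-j≡0⇒i≡j (l * l) (pos 3) eq)))
    eigen : ∀ l v → (∀ i → op^ 2 v i ≡ pos 3 * v i) → (∀ i → op M v i ≡ l * v i) → ∀ i → v i ≡ 0ℤ
    eigen l v q e i = [ (λ eq → contradiction eq (l²≢3 l)) , id ]′
      (ℤ.i*j≡0⇒i≡0∨j≡0 (l * l - pos 3) (begin
        (l * l - pos 3) * v i ≡⟨ ring l (v i) ⟩
        (l * (l * v i) + 0ℤ * (l * v i)) - pos 3 * v i
          ≡⟨ cong (λ s → (l * s + 0ℤ * s) - pos 3 * v i) (e i) ⟨
        (l * op M v i + 0ℤ * op M v i) - pos 3 * v i
          ≡⟨ cong (_- pos 3 * v i) (op-linear M l 0ℤ v v i) ⟨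
        op M (λ j → l * v j + 0ℤ * v j) i - pos 3 * v i
          ≡⟨ cong (_- pos 3 * v i) (op-cong M (λ j → trans (ℤ.+-identityʳ _) (sym (e j))) i) ⟩
        op^ 2 v i - pos 3 * v i ≡⟨ cong (_- pos 3 * v i) (q i) ⟩
        pos 3 * v i - pos 3 * v i ≡⟨ ℤ.+-inverseʳ (pos 3 * v i) ⟩
        0ℤ ∎))
      where
      ring : ∀ l v → (l * l - pos 3) * v ≡ (l * (l * v) + 0ℤ * (l * v)) - pos 3 * v
      ring = solve-∀

  -- x⁵ - 5x³ + 4x has the roots 0, ±1, ±2.
  quintic : (Fin n → ℤ) → Fin n → ℤ
  quintic z i = 1ℤ * op^ 5 z i + 1ℤ * (pos 4 * op^ 1 z i + - pos 5 * op^ 3 z i)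

  -- The image of q(M), q the quintic, is invariant, so it suffices that it contains no eigenvector.
  -- The norm bound excludes eigenvalues l with ∣ l ∣ ≥ 3. Every other integer l is a root of q, and
  -- for v = q(M) z self-adjointness gives ⟨ v , v ⟩ = q(l) ⟨ z , v ⟩ = 0. Symmetry thus takes the
  -- place of diagonalizability.
  quintic≡0 : AllEigenvaluesIntegral M → Symmetric M → (∀ v → ‖ op M v ‖ ℕ.≤ 2 ℕ.* ‖ v ‖) →
    ∀ z i → quintic z i ≡ 0ℤ
  quintic≡0 integral symmetric bounded z = no-eigenvector⇒zero M integral
    (λ v → Σ (Fin n → ℤ) λ z → ∀ i → v i ≡ quintic z i) invariant eigen (quintic z) (z , λ i → refl)
    where
    invariant : ∀ l v → (Σ (Fin n → ℤ) λ z → ∀ i → v i ≡ quintic z i) →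
      Σ (Fin n → ℤ) λ z → ∀ i → op M v i - l * v i ≡ quintic z i
    invariant l v (z , v≡) = z' , λ i → begin
      op M v i - l * v i
        ≡⟨ cong₂ (λ s t → s - l * t) (trans (op-cong M v≡ i) (op-quintic i)) (v≡ i) ⟩
      (1ℤ * op^ 6 z i + 1ℤ * (pos 4 * op^ 2 z i + - pos 5 * op^ 4 z i)) -
        l * (1ℤ * op^ 5 z i + 1ℤ * (pos 4 * op^ 1 z i + - pos 5 * op^ 3 z i))
        ≡⟨ ring l (op^ 1 z i) (op^ 2 z i) (op^ 3 z i) (op^ 4 z i) (op^ 5 z i) (op^ 6 z i) ⟩
      1ℤ * (1ℤ * op^ 6 z i + - l * op^ 5 z i) + 1ℤ * (pos 4 * (1ℤ * op^ 2 z i + - l * op^ 1 z i)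
        + - pos 5 * (1ℤ * op^ 4 z i + - l * op^ 3 z i))
        ≡⟨ cong₂ (λ s t → 1ℤ * s + 1ℤ * t) (shift 5 i)
             (cong₂ (λ s t → pos 4 * s + - pos 5 * t) (shift 1 i) (shift 3 i)) ⟨
      quintic z' i ∎
      where
      z' : Fin n → ℤ
      z' i = 1ℤ * op M z i + - l * z i
      shift : ∀ k i → op^ k z' i ≡ 1ℤ * op^ (suc k) z i + - l * op^ k z i
      shift k i = trans (op^-linear k 1ℤ (- l) (op M z) z i)
        (cong (λ s → 1ℤ * s + - l * op^ k z i) (op^-op k z i))
      op-quintic : ∀ i → op M (quintic z) i ≡ 1ℤ * op^ 6 z i + 1ℤ * (pos 4 * op^ 2 z i + - pos 5 * op^ 4 z i)
      op-quintic i = trans (op-linear M 1ℤ 1ℤ (op^ 5 z) (λ j → pos 4 * op^ 1 z j + - pos 5 * op^ 3 z j) i)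
        (cong (λ s → 1ℤ * op^ 6 z i + 1ℤ * s) (op-linear M (pos 4) (- pos 5) (op^ 1 z) (op^ 3 z) i))
      ring : ∀ l z₁ z₂ z₃ z₄ z₅ z₆ →
        (1ℤ * z₆ + 1ℤ * (pos 4 * z₂ + - pos 5 * z₄)) - l * (1ℤ * z₅ + 1ℤ * (pos 4 * z₁ + - pos 5 * z₃)) ≡
        1ℤ * (1ℤ * z₆ + - l * z₅) + 1ℤ * (pos 4 * (1ℤ * z₂ + - l * z₁) + - pos 5 * (1ℤ * z₄ + - l * z₃))
      ring = solve-∀
    module _ (l : ℤ) (v : Fin n → ℤ) (e : ∀ i → op M v i ≡ l * v i) where
      ⟨op^,⟩ : ∀ u → ⟨ op M u , v ⟩ ≡ l * ⟨ u , v ⟩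
      ⟨op^,⟩ u = begin
        ⟨ op M u , v ⟩ ≡⟨ op-self-adjoint M symmetric u v ⟩
        ⟨ u , op M v ⟩ ≡⟨ ∑-cong (λ i → trans (cong (u i *_) (e i)) (ring (u i) l (v i))) ⟩
        ∑ (λ i → l * (u i * v i)) ≡⟨ *-distribˡ-∑ l (λ i → u i * v i) ⟨
        l * ⟨ u , v ⟩ ∎
        where
        ring : ∀ u l v → u * (l * v) ≡ l * (u * v)
        ring = solve-∀
      root⇒zero : 1ℤ * (l * (l * (l * (l * l)))) + 1ℤ * (pos 4 * l + - pos 5 * (l * (l * l))) ≡ 0ℤ →
        ∀ z → (∀ i → v i ≡ quintic z i) → ∀ i → v i ≡ 0ℤ
      root⇒zero root z v≡ = ⟨v,v⟩≡0⇒v≡0 v (begin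
        ⟨ v , v ⟩ ≡⟨ ∑-cong (λ i → cong (_* v i) (v≡ i)) ⟩
        ⟨ quintic z , v ⟩
          ≡⟨ trans (⟨⟩-linearˡ 1ℤ 1ℤ (op^ 5 z) (λ j → pos 4 * op^ 1 z j + - pos 5 * op^ 3 z j) v)
               (cong (λ s → 1ℤ * ⟨ op^ 5 z , v ⟩ + 1ℤ * s) (⟨⟩-linearˡ (pos 4) (- pos 5) (op^ 1 z) (op^ 3 z) v)) ⟩
        1ℤ * ⟨ op^ 5 z , v ⟩ + 1ℤ * (pos 4 * ⟨ op^ 1 z , v ⟩ + - pos 5 * ⟨ op^ 3 z , v ⟩)
          ≡⟨ cong₂ (λ s t → 1ℤ * s + 1ℤ * (pos 4 * ⟨ op^ 1 z , v ⟩ + - pos 5 * t)) powers₅ powers₃ ⟩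
        1ℤ * (l * (l * (l * (l * ⟨ op^ 1 z , v ⟩)))) + 1ℤ * (pos 4 * ⟨ op^ 1 z , v ⟩ + - pos 5 * (l * (l * ⟨ op^ 1 z , v ⟩)))
          ≡⟨ cong (λ s → 1ℤ * (l * (l * (l * (l * s)))) + 1ℤ * (pos 4 * s + - pos 5 * (l * (l * s)))) (⟨op^,⟩ z) ⟩
        1ℤ * (l * (l * (l * (l * (l * ⟨ z , v ⟩))))) + 1ℤ * (pos 4 * (l * ⟨ z , v ⟩) + - pos 5 * (l * (l * (l * ⟨ z , v ⟩))))
          ≡⟨ ring l ⟨ z , v ⟩ ⟩
        (1ℤ * (l * (l * (l * (l * l)))) + 1ℤ * (pos 4 * l + - pos 5 * (l * (l * l)))) * ⟨ z , v ⟩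
          ≡⟨ cong (_* ⟨ z , v ⟩) root ⟩
        0ℤ * ⟨ z , v ⟩ ≡⟨ ℤ.*-zeroˡ ⟨ z , v ⟩ ⟩
        0ℤ ∎)
        where
        powers₃ : ⟨ op^ 3 z , v ⟩ ≡ l * (l * ⟨ op^ 1 z , v ⟩)
        powers₃ = trans (⟨op^,⟩ (op^ 2 z)) (cong (l *_) (⟨op^,⟩ (op^ 1 z)))
        powers₅ : ⟨ op^ 5 z , v ⟩ ≡ l * (l * (l * (l * ⟨ op^ 1 z , v ⟩)))
        powers₅ = trans (⟨op^,⟩ (op^ 4 z)) (cong (l *_) (trans (⟨op^,⟩ (op^ 3 z)) (cong (l *_) powers₃)))
        ring : ∀ l s → 1ℤ * (l * (l * (l * (l * (l * s))))) + 1ℤ * (pos 4 * (l * s) + - pos 5 * (l * (l * (l * s)))) ≡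
          (1ℤ * (l * (l * (l * (l * l)))) + 1ℤ * (pos 4 * l + - pos 5 * (l * (l * l)))) * s
        ring = solve-∀
      large⇒zero : ∀ m → ∣ l ∣ ≡ 3 ℕ.+ m → ∀ i → v i ≡ 0ℤ
      large⇒zero m ∣l∣≡ = ‖v‖≡0⇒v≡0 v (small ‖ v ‖ (subst (ℕ._≤ 2 ℕ.* ‖ v ‖) scaled (bounded v)))
        where
        scaled : ‖ op M v ‖ ≡ (3 ℕ.+ m) ℕ.* ‖ v ‖
        scaled = trans (ℕSum.sum-cong-≗ (λ i → trans (cong ∣_∣ (e i))
            (trans (ℤ.abs-* l (v i)) (cong (ℕ._* ∣ v i ∣) ∣l∣≡))))
          (sym (ℕSum.*-distribˡ-sum (3 ℕ.+ m) (λ i → ∣ v i ∣)))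
        small : ∀ N → (3 ℕ.+ m) ℕ.* N ℕ.≤ 2 ℕ.* N → N ≡ 0
        small zero    _ = refl
        small (suc N) p = contradiction (ℕ.*-cancelʳ-≤ (3 ℕ.+ m) 2 (suc N) p) λ { (ℕ.s≤s (ℕ.s≤s ())) }
    eigen : ∀ l v → (Σ (Fin n → ℤ) λ z → ∀ i → v i ≡ quintic z i) →
      (∀ i → op M v i ≡ l * v i) → ∀ i → v i ≡ 0ℤ
    eigen (pos 0) v (z , v≡) e = root⇒zero (pos 0) v e refl z v≡
    eigen (pos 1) v (z , v≡) e = root⇒zero (pos 1) v e refl z v≡
    eigen (pos 2) v (z , v≡) e = root⇒zero (pos 2) v e refl z v≡
    eigen (pos (suc (suc (suc m)))) v _ e = large⇒zero (pos (suc (suc (suc m)))) v e m refl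
    eigen -[1+ 0 ] v (z , v≡) e = root⇒zero -[1+ 0 ] v e refl z v≡
    eigen -[1+ 1 ] v (z , v≡) e = root⇒zero -[1+ 1 ] v e refl z v≡
    eigen -[1+ suc (suc m) ] v _ e = large⇒zero -[1+ suc (suc m) ] v e m refl

-- Cayley graphs

module CayleyGraph (G : FiniteGroup) where
  open FiniteGroup G public using (order)

  group : Group _ _
  group = record { isGroup = FiniteGroup.isGroup G }

  open Group group public using (_∙_; ε; _⁻¹; assoc; identityˡ; identityʳ; inverseˡ; inverseʳ)
  open GroupProperties group public
    using (∙-cancelˡ; ∙-cancelʳ; inverseˡ-unique; inverseʳ-unique; identityʳ-unique; ⁻¹-involutive; ⁻¹-anti-homo-∙; \\-leftDividesˡ; \\-leftDividesʳ)
  open DecMembership (_≟_ {order}) using (_∈?_)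

  Element : Set
  Element = Fin order

  translation : Element → Permutation′ order
  translation g = permutation (g ∙_) (g ⁻¹ ∙_) (\\-leftDividesˡ g) (\\-leftDividesʳ g)

  -- The elements whose inverse is listed, so that the neighbours of a are the s ∙ a with s in ss.
  connectionSet : List Element → Element → Bool
  connectionSet ss g = does (g ⁻¹ ∈? ss)

  adjacency : List Element → Matrix order
  adjacency ss = cayleyAdj G (connectionSet ss)

  shiftSum : List Element → (Element → ℤ) → Element → ℤ
  shiftSum []       v a = 0ℤ
  shiftSum (s ∷ ss) v a = v (s ∙ a) + shiftSum ss v a

  InverseClosed : List Element → Set
  InverseClosed ss = ∀ {s} → s ∈ ss → s ⁻¹ ∈ ss

  connectionSet-inverse : ∀ {ss} → InverseClosed ss → ∀ g → connectionSet ss (g ⁻¹) ≡ connectionSet ss g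
  connectionSet-inverse {ss} closed g with g ⁻¹ ∈? ss
  ... | yes g⁻¹∈ss = dec-true (g ⁻¹ ⁻¹ ∈? ss) (closed g⁻¹∈ss)
  ... | no  g⁻¹∉ss = dec-false (g ⁻¹ ⁻¹ ∈? ss) λ p → g⁻¹∉ss (subst (_∈ ss) (⁻¹-involutive (g ⁻¹)) (closed p))

  inverse-quotient : ∀ a b → (a ∙ b ⁻¹) ⁻¹ ≡ b ∙ a ⁻¹
  inverse-quotient a b = trans (⁻¹-anti-homo-∙ a (b ⁻¹)) (cong (_∙ a ⁻¹) (⁻¹-involutive b))

  adjacency-symmetric : ∀ {ss} → InverseClosed ss → Symmetric (adjacency ss)
  adjacency-symmetric {ss} closed a b = cong (λ s → if s then 1ℤ else 0ℤ)
    (trans (sym (connectionSet-inverse closed (a ∙ b ⁻¹))) (cong (connectionSet ss) (inverse-quotient a b)))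

  -- The new element contributes the permutation matrix of left multiplication by `s`; freshness of
  -- `s` prevents an edge from being counted twice.
  adjacency-∷ : ∀ {s ss} → s ∉ ss → ∀ a b → adjacency (s ∷ ss) a b ≡ δ (s ∙ a) b + adjacency ss a b
  adjacency-∷ {s} {ss} s∉ss a b with s ∙ a ≟ b
  ... | yes sa≡b = trans
    (cong (λ s → if s then 1ℤ else 0ℤ) (dec-true ((a ∙ b ⁻¹) ⁻¹ ∈? s ∷ ss) (here quotient≡s)))
    (sym (cong (λ s → 1ℤ + (if s then 1ℤ else 0ℤ))
      (dec-false ((a ∙ b ⁻¹) ⁻¹ ∈? ss) λ p → s∉ss (subst (_∈ ss) quotient≡s p))))
    where
    quotient≡s : (a ∙ b ⁻¹) ⁻¹ ≡ s
    quotient≡s = trans (inverse-quotient a b) (trans (cong (_∙ a ⁻¹) (sym sa≡b))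
      (trans (assoc s a (a ⁻¹)) (trans (cong (s ∙_) (inverseʳ a)) (identityʳ s))))
  ... | no sa≢b = trans (cong (λ s → if s then 1ℤ else 0ℤ) same) (sym (ℤ.+-identityˡ (adjacency ss a b)))
    where
    quotient≢s : (a ∙ b ⁻¹) ⁻¹ ≢ s
    quotient≢s eq = sa≢b (trans (cong (_∙ a) (trans (sym eq) (inverse-quotient a b)))
      (trans (assoc b (a ⁻¹) a) (trans (cong (b ∙_) (inverseˡ a)) (identityʳ b))))
    same-if : Dec ((a ∙ b ⁻¹) ⁻¹ ∈ ss) → connectionSet (s ∷ ss) (a ∙ b ⁻¹) ≡ connectionSet ss (a ∙ b ⁻¹)
    same-if (yes p) = trans (dec-true ((a ∙ b ⁻¹) ⁻¹ ∈? s ∷ ss) (there p)) (sym (dec-true ((a ∙ b ⁻¹) ⁻¹ ∈? ss) p))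
    same-if (no ¬p) = trans
      (dec-false ((a ∙ b ⁻¹) ⁻¹ ∈? s ∷ ss) λ { (here eq) → quotient≢s eq ; (there p) → ¬p p })
      (sym (dec-false ((a ∙ b ⁻¹) ⁻¹ ∈? ss) ¬p))
    same : connectionSet (s ∷ ss) (a ∙ b ⁻¹) ≡ connectionSet ss (a ∙ b ⁻¹)
    same = same-if ((a ∙ b ⁻¹) ⁻¹ ∈? ss)

  op-adjacency : ∀ {ss} → Unique ss → ∀ v a → op (adjacency ss) v a ≡ shiftSum ss v a
  op-adjacency {[]} [] v a = ∑-zero λ b → ℤ.*-zeroˡ (v b)
  op-adjacency {s ∷ ss} (s∉ss ∷ unique) v a = begin
    ∑ (λ b → adjacency (s ∷ ss) a b * v b)
      ≡⟨ ∑-cong (λ b → trans (cong (_* v b) (adjacency-∷ (All¬⇒¬Any s∉ss) a b)) (ℤ.*-distribʳ-+ (v b) (δ (s ∙ a) b) (adjacency ss a b))) ⟩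
    ∑ (λ b → δ (s ∙ a) b * v b + adjacency ss a b * v b)
      ≡⟨ ∑-distrib-+ (λ b → δ (s ∙ a) b * v b) (λ b → adjacency ss a b * v b) ⟩
    ∑ (λ b → δ (s ∙ a) b * v b) + op (adjacency ss) v a
      ≡⟨ cong₂ _+_ (∑-δ (s ∙ a) v) (op-adjacency unique v a) ⟩
    v (s ∙ a) + shiftSum ss v a ∎

  -- Serves where a test vector is evaluated at a point and one further word may or may not equal
  -- `ε`: the value is 1 or 2, and the case need not be decided.
  0≢1+δ : ∀ (g : Element) → 0ℤ ≢ 1ℤ + δ ε g
  0≢1+δ g with ε ≟ g
  ... | yes _ = λ ()
  ... | no _ = λ ()

  module _ (cayleyIntegral : CayleyIntegral G) where
    adjacency-integral : ∀ {ss} → ε ∉ ss → InverseClosed ss → AllEigenvaluesIntegral (adjacency ss)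
    adjacency-integral {ss} ε∉ss closed = cayleyIntegral (connectionSet ss)
      ( dec-false (ε ⁻¹ ∈? ss) (λ p → ε∉ss (subst (_∈ ss) (⁻¹-involutive ε) (closed p)))
      , connectionSet-inverse closed)

    shiftSum²≡3⇒zero : ∀ {ss} → Unique ss → ε ∉ ss → InverseClosed ss →
      ∀ v → (∀ a → shiftSum ss (shiftSum ss v) a ≡ pos 3 * v a) → ∀ a → v a ≡ 0ℤ
    shiftSum²≡3⇒zero {ss} unique ε∉ss closed v eq =
      op²≡3⇒zero (adjacency ss) (adjacency-integral ε∉ss closed) v λ a → begin
        op (adjacency ss) (op (adjacency ss) v) a ≡⟨ op-cong (adjacency ss) (op-adjacency unique v) a ⟩
        op (adjacency ss) (shiftSum ss v) a       ≡⟨ op-adjacency unique (shiftSum ss v) a ⟩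
        shiftSum ss (shiftSum ss v) a             ≡⟨ eq a ⟩
        pos 3 * v a                               ∎

    -- In the Cayley graph of {p, q} the words α k, β k are the two ends of the walks of length k
    -- without backtracking; the quintic x⁵ - 5x³ + 4x turns into α 5 + β 5 - α 1 - β 1.
    module _ {p q : Element} (p≢ε : p ≢ ε) (q≢ε : q ≢ ε) (p≢q : p ≢ q) (closed : InverseClosed (p ∷ q ∷ []))
      (α β : ℕ → Element → Element)
      (α₀ : ∀ a → α 0 a ≡ a) (β₀ : ∀ a → β 0 a ≡ a) (α₁ : ∀ a → α 1 a ≡ p ∙ a) (β₁ : ∀ a → β 1 a ≡ q ∙ a)
      -- On the left are the four walks of k + 2 letters that take a first step `p` or `q` and then
      -- follow α or β. Two of them have no backtracking; in the other two the first two letters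
      -- cancel.
      (step : ∀ k (v : Element → ℤ) a →
        (v (α (suc k) (p ∙ a)) + v (β (suc k) (p ∙ a))) + (v (α (suc k) (q ∙ a)) + v (β (suc k) (q ∙ a))) ≡
        (v (α (suc (suc k)) a) + v (β (suc (suc k)) a)) + (v (α k a) + v (β k a)))
      where

      private
        M : Matrix order
        M = adjacency (p ∷ q ∷ [])

        op-M : ∀ v a → op M v a ≡ v (p ∙ a) + v (q ∙ a)
        op-M v a = trans (op-adjacency ((p≢q ∷ []) ∷ [] ∷ []) v a)
          (cong (v (p ∙ a) +_) (ℤ.+-identityʳ (v (q ∙ a))))

        translation-norm : ∀ g (v : Element → ℤ) → ℕSum.sum (λ a → ∣ v (g ∙ a) ∣) ≡ ‖ v ‖
        translation-norm g v = sym (ℕSum.∑-permute (λ a → ∣ v a ∣) (translation g))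

        -- Left translations permute the coordinates, so each of the two generators contributes at
        -- most one ‖ v ‖.
        bounded : ∀ v → ‖ op M v ‖ ℕ.≤ 2 ℕ.* ‖ v ‖
        bounded v = subst (‖ op M v ‖ ℕ.≤_)
          (trans (ℕSum.∑-distrib-+ (λ a → ∣ v (p ∙ a) ∣) (λ a → ∣ v (q ∙ a) ∣))
            (cong₂ ℕ._+_ (translation-norm p v) (trans (translation-norm q v) (sym (ℕ.+-identityʳ ‖ v ‖)))))
          (sum-mono λ a → subst (λ s → ∣ s ∣ ℕ.≤ ∣ v (p ∙ a) ∣ ℕ.+ ∣ v (q ∙ a) ∣) (sym (op-M v a))
            (ℤ.∣i+j∣≤∣i∣+∣j∣ (v (p ∙ a)) (v (q ∙ a))))

        module _ (z : Element → ℤ) where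
          W : ℕ → Element → ℤ
          W k a = z (α k a) + z (β k a)

          -- The Chebyshev recurrence, with `W k` in the role of 2 cos kθ. It fails at index 0,
          -- where both walks coincide and M (W 0) = 2 W 1. The coefficients 1, 3 and 1, 5, 10 below
          -- are binomial, as in the expansion of (2 cos θ)ᵏ.
          op-W : ∀ k a → op M (W (suc k)) a ≡ W (suc (suc k)) a + W k a
          op-W k a = trans (op-M (W (suc k)) a) (step k z a)

          op¹ : ∀ a → op^ M 1 z a ≡ W 1 a
          op¹ a = trans (op-M z a) (sym (cong₂ _+_ (cong z (α₁ a)) (cong z (β₁ a))))

          op-W₀ : ∀ a → op M (W 0) a ≡ W 1 a + W 1 a
          op-W₀ a = begin
            op M (W 0) a ≡⟨ op-cong M (λ b → trans (cong₂ _+_ (cong z (α₀ b)) (cong z (β₀ b))) (ring (z b))) a ⟩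
            op M (λ b → 1ℤ * z b + 1ℤ * z b) a ≡⟨ op-linear M 1ℤ 1ℤ z z a ⟩
            1ℤ * op M z a + 1ℤ * op M z a ≡⟨ ring (op M z a) ⟨
            op M z a + op M z a ≡⟨ cong₂ _+_ (op¹ a) (op¹ a) ⟩
            W 1 a + W 1 a ∎
            where
            ring : ∀ s → s + s ≡ 1ℤ * s + 1ℤ * s
            ring = solve-∀

          op² : ∀ a → op^ M 2 z a ≡ 1ℤ * W 2 a + 1ℤ * W 0 a
          op² a = trans (op-cong M op¹ a) (trans (op-W 0 a) (sym (cong₂ _+_ (ℤ.*-identityˡ (W 2 a)) (ℤ.*-identityˡ (W 0 a)))))

          op³ : ∀ a → op^ M 3 z a ≡ 1ℤ * W 3 a + pos 3 * W 1 a
          op³ a = begin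
            op^ M 3 z a ≡⟨ op-cong M op² a ⟩
            op M (λ b → 1ℤ * W 2 b + 1ℤ * W 0 b) a ≡⟨ op-linear M 1ℤ 1ℤ (W 2) (W 0) a ⟩
            1ℤ * op M (W 2) a + 1ℤ * op M (W 0) a ≡⟨ cong₂ (λ s t → 1ℤ * s + 1ℤ * t) (op-W 1 a) (op-W₀ a) ⟩
            1ℤ * (W 3 a + W 1 a) + 1ℤ * (W 1 a + W 1 a) ≡⟨ ring (W 3 a) (W 1 a) ⟩
            1ℤ * W 3 a + pos 3 * W 1 a ∎
            where
            ring : ∀ w₃ w₁ → 1ℤ * (w₃ + w₁) + 1ℤ * (w₁ + w₁) ≡ 1ℤ * w₃ + pos 3 * w₁
            ring = solve-∀

          op⁴ : ∀ a → op^ M 4 z a ≡ 1ℤ * (1ℤ * W 4 a + pos 4 * W 2 a) + pos 3 * W 0 a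
          op⁴ a = begin
            op^ M 4 z a ≡⟨ op-cong M op³ a ⟩
            op M (λ b → 1ℤ * W 3 b + pos 3 * W 1 b) a ≡⟨ op-linear M 1ℤ (pos 3) (W 3) (W 1) a ⟩
            1ℤ * op M (W 3) a + pos 3 * op M (W 1) a ≡⟨ cong₂ (λ s t → 1ℤ * s + pos 3 * t) (op-W 2 a) (op-W 0 a) ⟩
            1ℤ * (W 4 a + W 2 a) + pos 3 * (W 2 a + W 0 a) ≡⟨ ring (W 4 a) (W 2 a) (W 0 a) ⟩
            1ℤ * (1ℤ * W 4 a + pos 4 * W 2 a) + pos 3 * W 0 a ∎
            where
            ring : ∀ w₄ w₂ w₀ → 1ℤ * (w₄ + w₂) + pos 3 * (w₂ + w₀) ≡ 1ℤ * (1ℤ * w₄ + pos 4 * w₂) + pos 3 * w₀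
            ring = solve-∀

          op⁵ : ∀ a → op^ M 5 z a ≡ W 5 a + (pos 5 * W 3 a + pos 10 * W 1 a)
          op⁵ a = begin
            op^ M 5 z a ≡⟨ op-cong M op⁴ a ⟩
            op M (λ b → 1ℤ * (1ℤ * W 4 b + pos 4 * W 2 b) + pos 3 * W 0 b) a
              ≡⟨ trans (op-linear M 1ℤ (pos 3) (λ b → 1ℤ * W 4 b + pos 4 * W 2 b) (W 0) a)
                   (cong (λ s → 1ℤ * s + pos 3 * op M (W 0) a) (op-linear M 1ℤ (pos 4) (W 4) (W 2) a)) ⟩
            1ℤ * (1ℤ * op M (W 4) a + pos 4 * op M (W 2) a) + pos 3 * op M (W 0) a
              ≡⟨ cong₂ (λ s t → 1ℤ * s + pos 3 * t)
                   (cong₂ (λ s t → 1ℤ * s + pos 4 * t) (op-W 3 a) (op-W 1 a)) (op-W₀ a) ⟩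
            1ℤ * (1ℤ * (W 5 a + W 3 a) + pos 4 * (W 3 a + W 1 a)) + pos 3 * (W 1 a + W 1 a)
              ≡⟨ ring (W 5 a) (W 3 a) (W 1 a) ⟩
            W 5 a + (pos 5 * W 3 a + pos 10 * W 1 a) ∎
            where
            ring : ∀ w₅ w₃ w₁ → 1ℤ * (1ℤ * (w₅ + w₃) + pos 4 * (w₃ + w₁)) + pos 3 * (w₁ + w₁) ≡
              w₅ + (pos 5 * w₃ + pos 10 * w₁)
            ring = solve-∀

          W₅≡W₁ : ∀ a → W 5 a ≡ W 1 a
          W₅≡W₁ a = ℤ.i-j≡0⇒i≡j (W 5 a) (W 1 a) (begin
            W 5 a - W 1 a ≡⟨ ring (W 5 a) (W 3 a) (W 1 a) ⟩
            1ℤ * (W 5 a + (pos 5 * W 3 a + pos 10 * W 1 a)) + 1ℤ * (pos 4 * W 1 a + - pos 5 * (1ℤ * W 3 a + pos 3 * W 1 a))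
              ≡⟨ cong₂ (λ s t → 1ℤ * s + 1ℤ * t) (op⁵ a) (cong₂ (λ s t → pos 4 * s + - pos 5 * t) (op¹ a) (op³ a)) ⟨
            quintic M z a ≡⟨ quintic≡0 M (adjacency-integral ε∉ closed) (adjacency-symmetric closed) bounded z a ⟩
            0ℤ ∎)
            where
            ring : ∀ w₅ w₃ w₁ → w₅ - w₁ ≡
              1ℤ * (w₅ + (pos 5 * w₃ + pos 10 * w₁)) + 1ℤ * (pos 4 * w₁ + - pos 5 * (1ℤ * w₃ + pos 3 * w₁))
            ring = solve-∀
            ε∉ : ε ∉ p ∷ q ∷ []
            ε∉ (here ε≡p) = p≢ε (sym ε≡p)
            ε∉ (there (here ε≡q)) = q≢ε (sym ε≡q)

      -- Evaluate W 5 = W 1 at p⁻¹ for the indicator of `ε`. The one-letter walk p p⁻¹ ends at `ε`,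
      -- so the right side is positive and a five-letter walk must end there too.
      five-steps : α 5 (p ⁻¹) ≡ ε ⊎ β 5 (p ⁻¹) ≡ ε
      five-steps with α 5 (p ⁻¹) ≟ ε | β 5 (p ⁻¹) ≟ ε
      ... | yes α≡ε | _ = inj₁ α≡ε
      ... | no _ | yes β≡ε = inj₂ β≡ε
      ... | no α≢ε | no β≢ε = contradiction
        (begin
          0ℤ ≡⟨ cong₂ _+_ (δ-≢ (α≢ε ∘ sym)) (δ-≢ (β≢ε ∘ sym)) ⟨
          δ ε (α 5 (p ⁻¹)) + δ ε (β 5 (p ⁻¹)) ≡⟨ W₅≡W₁ (δ ε) (p ⁻¹) ⟩
          δ ε (α 1 (p ⁻¹)) + δ ε (β 1 (p ⁻¹))
            ≡⟨ cong (_+ δ ε (β 1 (p ⁻¹))) (trans (cong (δ ε) (trans (α₁ (p ⁻¹)) (inverseʳ p))) (δ-refl ε)) ⟩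
          1ℤ + δ ε (β 1 (p ⁻¹)) ∎)
        (0≢1+δ (β 1 (p ⁻¹)))

-- Groups with non-commuting involutions

-- The form to which `shiftSum` over a three-element list unfolds, including the final `0ℤ`.
sum₃ : ℤ → ℤ → ℤ → ℤ
sum₃ p q r = p + (q + (r + 0ℤ))

sum₃-cong : ∀ {p p' q q' r r'} → p ≡ p' → q ≡ q' → r ≡ r' → sum₃ p q r ≡ sum₃ p' q' r'
sum₃-cong refl refl refl = refl

-- The relation (f g)³ = 1 solved for g f g. Working with functions avoids reassociating words and
-- lets the lemma be used again with a rotation and its inverse exchanged.
cube⇒swap : {X : Set} {f f⁻ g g⁻ : X → X} → (∀ a → f⁻ (f a) ≡ a) → (∀ a → g⁻ (g a) ≡ a) →
  (∀ a → f (g (f (g (f (g a))))) ≡ a) → ∀ a → g (f (g a)) ≡ f⁻ (g⁻ (f⁻ a))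
cube⇒swap {f = f} {f⁻} {g} {g⁻} f⁻f g⁻g cube a = begin
  g (f (g a)) ≡⟨ f⁻f _ ⟨
  f⁻ (f (g (f (g a)))) ≡⟨ cong f⁻ (g⁻g _) ⟨
  f⁻ (g⁻ (g (f (g (f (g a)))))) ≡⟨ cong (f⁻ ∘ g⁻) (f⁻f _) ⟨
  f⁻ (g⁻ (f⁻ (f (g (f (g (f (g a)))))))) ≡⟨ cong (f⁻ ∘ g⁻ ∘ f⁻) (cube a) ⟩
  f⁻ (g⁻ (f⁻ a)) ∎

-- Inverts both sides of the relation: `a` is g (f (g b)) for b = f (g (f a)), after which the outer
-- operators cancel.
swap-inverse : {X : Set} {f f⁻ g g⁻ : X → X} → (∀ a → f⁻ (f a) ≡ a) → (∀ a → g⁻ (g a) ≡ a) →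
  (∀ a → g (f (g a)) ≡ f⁻ (g⁻ (f⁻ a))) → ∀ a → g⁻ (f⁻ (g⁻ a)) ≡ f (g (f a))
swap-inverse {f = f} {f⁻} {g} {g⁻} f⁻f g⁻g swap a = begin
  g⁻ (f⁻ (g⁻ a)) ≡⟨ cong (g⁻ ∘ f⁻ ∘ g⁻) (trans (swap b) (trans (cong (f⁻ ∘ g⁻) (f⁻f _)) (trans (cong f⁻ (g⁻g _)) (f⁻f a)))) ⟨
  g⁻ (f⁻ (g⁻ (g (f (g b))))) ≡⟨ trans (cong (g⁻ ∘ f⁻) (g⁻g _)) (trans (cong g⁻ (f⁻f _)) (g⁻g b)) ⟩
  b ∎
  where
  b = f (g (f a))

module CayleyIntegralGroup (G : FiniteGroup) (cayleyIntegral : CayleyIntegral G) where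
  open CayleyGraph G

  Commute : Element → Element → Set
  Commute g h = g ∙ h ≡ h ∙ g

  Involution : Element → Set
  Involution x = x ≢ ε × x ∙ x ≡ ε

  cancel-square : ∀ {x} → x ∙ x ≡ ε → ∀ a → x ∙ (x ∙ a) ≡ a
  cancel-square {x} x²≡ε a = trans (sym (assoc x x a)) (trans (cong (_∙ a) x²≡ε) (identityˡ a))

  commute-past : ∀ {g h} → Commute g h → ∀ a → g ∙ (h ∙ a) ≡ h ∙ (g ∙ a)
  commute-past {g} {h} comm a = trans (sym (assoc g h a)) (trans (cong (_∙ a) comm) (assoc h g a))

  past-commute : ∀ {g h} → (∀ a → g ∙ (h ∙ a) ≡ h ∙ (g ∙ a)) → Commute g h
  past-commute {g} {h} past =
    trans (sym (cong (g ∙_) (identityʳ h))) (trans (past ε) (cong (h ∙_) (identityʳ g)))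

  fixes⇒ε : ∀ {g} → (∀ a → g ∙ a ≡ a) → g ≡ ε
  fixes⇒ε {g} fixes = trans (sym (identityʳ g)) (fixes ε)

  self-inverse : ∀ {x} → x ∙ x ≡ ε → x ⁻¹ ≡ x
  self-inverse {x} x²≡ε = sym (inverseˡ-unique x x x²≡ε)

  commute-∙ : ∀ {g h k} → Commute g k → Commute h k → Commute (g ∙ h) k
  commute-∙ {g} {h} {k} gk hk =
    trans (assoc g h k) (trans (cong (g ∙_) hk) (commute-past gk h))

  -- The first letter acts first and so stands rightmost: two steps give q p a. This order lets a
  -- repeated first letter meet its copy in `a` by mere unfolding.
  alternate : Element → Element → ℕ → Element → Element
  alternate p q zero    a = a
  alternate p q (suc k) a = alternate q p k (p ∙ a)

  iterate : Element → ℕ → Element → Element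
  iterate p zero    a = a
  iterate p (suc k) a = iterate p k (p ∙ a)

  act : List Element → Element → Element
  act gs a = foldr _∙_ a gs

  act-assoc : ∀ gs a → act gs ε ∙ a ≡ act gs a
  act-assoc []       a = identityˡ a
  act-assoc (g ∷ gs) a = trans (assoc g (act gs ε) a) (cong (g ∙_) (act-assoc gs a))

  -- Relations are handled as right-nested left multiplications of an arbitrary `a`; this turns a
  -- relation known at `ε` into that form.
  act≡ε⇒fixes : ∀ gs → act gs ε ≡ ε → ∀ a → act gs a ≡ a
  act≡ε⇒fixes gs eq a = trans (sym (act-assoc gs a)) (trans (cong (_∙ a) eq) (identityˡ a))

  -- {x, y} generates a dihedral group, whose Cayley graph is a cycle.
  involutions-cube : ∀ {x y} → Involution x → Involution y → ¬ Commute x y →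
    ∀ a → x ∙ (y ∙ (x ∙ (y ∙ (x ∙ (y ∙ a))))) ≡ a
  involutions-cube {x} {y} (x≢ε , x²) (y≢ε , y²) x≁y a with
    -- From the starting point y⁻¹ = y the two walks end at y x y x, whose triviality would make `x`
    -- and `y` commute, and at x y x y x y, the desired cube.
    five-steps cayleyIntegral y≢ε x≢ε (λ { refl → x≁y refl }) closed (alternate y x) (alternate x y)
      (λ a → refl) (λ a → refl) (λ a → refl) (λ a → refl) step
    where
    closed : InverseClosed (y ∷ x ∷ [])
    closed (here refl)         = here (self-inverse y²)
    closed (there (here refl)) = there (here (self-inverse x²))
    step : ∀ k (v : Element → ℤ) a →
      (v (alternate y x (suc k) (y ∙ a)) + v (alternate x y (suc k) (y ∙ a))) +
      (v (alternate y x (suc k) (x ∙ a)) + v (alternate x y (suc k) (x ∙ a))) ≡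
      (v (alternate y x (suc (suc k)) a) + v (alternate x y (suc (suc k)) a)) +
      (v (alternate y x k a) + v (alternate x y k a))
    step k v a = begin
      (v (alternate x y k (y ∙ (y ∙ a))) + s) + (t + v (alternate y x k (x ∙ (x ∙ a))))
        ≡⟨ cong₂ (λ b c → (v (alternate x y k b) + s) + (t + v (alternate y x k c)))
             (cancel-square y² a) (cancel-square x² a) ⟩
      (v (alternate x y k a) + s) + (t + v (alternate y x k a))
        ≡⟨ ring (v (alternate x y k a)) s t (v (alternate y x k a)) ⟩
      (s + t) + (v (alternate y x k a) + v (alternate x y k a)) ∎
      where
      s t : ℤ
      s = v (alternate x y (suc k) (y ∙ a))
      t = v (alternate y x (suc k) (x ∙ a))
      ring : ∀ u s t w → (u + s) + (t + w) ≡ (s + t) + (w + u)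
      ring = solve-∀
  ... | inj₁ eq = contradiction x∼y x≁y
    where
    b : Element
    b = y ∙ (x ∙ ε)
    yxb≡ε : y ∙ (x ∙ b) ≡ ε
    yxb≡ε = trans (cong (λ c → y ∙ (x ∙ (y ∙ (x ∙ c)))) (sym (inverseʳ y))) eq
    x∼y : Commute x y
    x∼y = begin
      x ∙ y ≡⟨ cong (x ∙_) (identityʳ y) ⟨
      x ∙ (y ∙ ε) ≡⟨ cong (λ c → x ∙ (y ∙ c)) yxb≡ε ⟨
      x ∙ (y ∙ (y ∙ (x ∙ b))) ≡⟨ cong (x ∙_) (cancel-square y² (x ∙ b)) ⟩
      x ∙ (x ∙ b) ≡⟨ cancel-square x² b ⟩
      y ∙ (x ∙ ε) ≡⟨ cong (y ∙_) (identityʳ x) ⟩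
      y ∙ x ∎
  ... | inj₂ eq = act≡ε⇒fixes (x ∷ y ∷ x ∷ y ∷ x ∷ y ∷ [])
    (trans (cong (λ c → x ∙ (y ∙ (x ∙ (y ∙ (x ∙ c))))) (trans (identityʳ y) (sym (self-inverse y²)))) eq) a

  braid : ∀ {x y} → Involution x → Involution y → ¬ Commute x y → ∀ a → x ∙ (y ∙ (x ∙ a)) ≡ y ∙ (x ∙ (y ∙ a))
  braid {x} {y} ix@(_ , x²) iy@(_ , y²) x≁y a = begin
    x ∙ (y ∙ (x ∙ a)) ≡⟨ cong (λ b → x ∙ (y ∙ (x ∙ b))) (cancel-square y² a) ⟨
    x ∙ (y ∙ (x ∙ (y ∙ (y ∙ a)))) ≡⟨ cong (λ b → x ∙ (y ∙ (x ∙ (y ∙ b)))) (cancel-square x² (y ∙ a)) ⟨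
    x ∙ (y ∙ (x ∙ (y ∙ (x ∙ (x ∙ (y ∙ a)))))) ≡⟨ cong (λ b → x ∙ (y ∙ (x ∙ (y ∙ (x ∙ b))))) (cancel-square y² (x ∙ (y ∙ a))) ⟨
    x ∙ (y ∙ (x ∙ (y ∙ (x ∙ (y ∙ (y ∙ (x ∙ (y ∙ a)))))))) ≡⟨ involutions-cube ix iy x≁y (y ∙ (x ∙ (y ∙ a))) ⟩
    y ∙ (x ∙ (y ∙ a)) ∎

  involution-∙ : ∀ {t x} → Involution t → Involution x → Commute t x → t ≢ x → Involution (t ∙ x)
  involution-∙ {t} {x} (_ , t²) (_ , x²) tx t≢x =
      (λ tx≡ε → t≢x (trans (inverseˡ-unique t x tx≡ε) (self-inverse x²)))
    , (begin
        (t ∙ x) ∙ (t ∙ x) ≡⟨ assoc t x (t ∙ x) ⟩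
        t ∙ (x ∙ (t ∙ x)) ≡⟨ cong (t ∙_) (commute-past tx x) ⟨
        t ∙ (t ∙ (x ∙ x)) ≡⟨ cancel-square t² (x ∙ x) ⟩
        x ∙ x ≡⟨ x² ⟩
        ε ∎)

  module _ {x y : Element} (ix : Involution x) (iy : Involution y) (x≁y : ¬ Commute x y) where

    private
      xx : ∀ a → x ∙ (x ∙ a) ≡ a
      xx = cancel-square (proj₂ ix)
      yy : ∀ a → y ∙ (y ∙ a) ≡ a
      yy = cancel-square (proj₂ iy)
      cube : ∀ a → x ∙ (y ∙ (x ∙ (y ∙ (x ∙ (y ∙ a))))) ≡ a
      cube = involutions-cube ix iy x≁y

    -- Otherwise t x and y are non-commuting involutions, so that ε = (t x y)³ = t.
    no-central-involution : ∀ {t} → Involution t → Commute t x → ¬ Commute t y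
    no-central-involution {t} it@(t≢ε , t²) tx ty = t≢ε (fixes⇒ε λ a → begin
      t ∙ a ≡⟨ cong (t ∙_) (cube a) ⟨
      t ∙ r (r (r a)) ≡⟨ t-past-r (r (r a)) ⟩
      r (t ∙ r (r a)) ≡⟨ cong r (t-past-r (r a)) ⟩
      r (r (t ∙ r a)) ≡⟨ cancel-square t² _ ⟨
      t ∙ (t ∙ r (r (t ∙ r a))) ≡⟨ cong (t ∙_) (t-past-r (r (t ∙ r a))) ⟩
      t ∙ r (t ∙ r (t ∙ r a)) ≡⟨ trans (assoc t x _) (cong (λ b → t ∙ r b)
                                   (trans (assoc t x _) (cong (λ b → t ∙ r b) (assoc t x (y ∙ a))))) ⟨
      (t ∙ x) ∙ (y ∙ ((t ∙ x) ∙ (y ∙ ((t ∙ x) ∙ (y ∙ a)))))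
        ≡⟨ involutions-cube (involution-∙ it ix tx t≢x) iy tx≁y a ⟩
      a ∎)
      where
      r : Element → Element
      r a = x ∙ (y ∙ a)
      t-past-r : ∀ a → t ∙ r a ≡ r (t ∙ a)
      t-past-r a = trans (commute-past tx (y ∙ a)) (cong (x ∙_) (commute-past ty a))
      t≢x : t ≢ x
      t≢x refl = x≁y ty
      tx≁y : ¬ Commute (t ∙ x) y
      tx≁y eq = x≁y (∙-cancelˡ t (x ∙ y) (y ∙ x)
        (trans (sym (assoc t x y)) (trans eq (sym (commute-past ty x)))))

    -- Otherwise x, y, t satisfy the relations of S₄ and (t x y)³ = ε, and these give x = t y.
    commuting-involution : ∀ {t} → Involution t → Commute t x → t ≡ x
    commuting-involution {t} it@(_ , t²) tx with t ≟ x
    ... | yes t≡x = t≡x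
    ... | no  t≢x = contradiction (past-commute λ a → begin
        x ∙ (y ∙ a) ≡⟨ x≡ty (y ∙ a) ⟩
        t ∙ (y ∙ (y ∙ a)) ≡⟨ cong (t ∙_) (yy a) ⟩
        t ∙ a ≡⟨ cong (t ∙_) (xx a) ⟨
        t ∙ (x ∙ (x ∙ a)) ≡⟨ cong (t ∙_) (x≡ty (x ∙ a)) ⟩
        t ∙ (t ∙ (y ∙ (x ∙ a))) ≡⟨ tt (y ∙ (x ∙ a)) ⟩
        y ∙ (x ∙ a) ∎) x≁y
      where
      tt : ∀ a → t ∙ (t ∙ a) ≡ a
      tt = cancel-square t²
      ip : Involution (t ∙ x)
      ip = involution-∙ it ix tx t≢x
      t≁y : ¬ Commute t y
      t≁y = no-central-involution it tx
      p≁y : ¬ Commute (t ∙ x) y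
      p≁y = no-central-involution ip (commute-∙ tx refl)
      -- Both sides are p y p for p = t x: the left by the braid relation of `x` and `y`, the right
      -- by those of p, `t` and `x` with `y`. Cancelling `t`, `y` and `x` leaves `yt≡tyx`.
      pyp : ∀ a → t ∙ (y ∙ (x ∙ (y ∙ (t ∙ a)))) ≡ t ∙ (y ∙ (t ∙ (x ∙ (y ∙ (x ∙ a)))))
      pyp a = begin
        t ∙ (y ∙ (x ∙ (y ∙ (t ∙ a)))) ≡⟨ cong (t ∙_) (braid ix iy x≁y (t ∙ a)) ⟨
        t ∙ (x ∙ (y ∙ (x ∙ (t ∙ a)))) ≡⟨ cong (λ b → t ∙ (x ∙ (y ∙ b))) (commute-past tx a) ⟨
        t ∙ (x ∙ (y ∙ (t ∙ (x ∙ a)))) ≡⟨ trans (assoc t x _) (cong (λ b → t ∙ (x ∙ (y ∙ b))) (assoc t x a)) ⟨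
        (t ∙ x) ∙ (y ∙ ((t ∙ x) ∙ a)) ≡⟨ braid ip iy p≁y a ⟩
        y ∙ ((t ∙ x) ∙ (y ∙ a)) ≡⟨ cong (y ∙_) (assoc t x (y ∙ a)) ⟩
        y ∙ (t ∙ (x ∙ (y ∙ a))) ≡⟨ cong (λ b → y ∙ (t ∙ b)) (yy (x ∙ (y ∙ a))) ⟨
        y ∙ (t ∙ (y ∙ (y ∙ (x ∙ (y ∙ a))))) ≡⟨ braid it iy t≁y (y ∙ (x ∙ (y ∙ a))) ⟨
        t ∙ (y ∙ (t ∙ (y ∙ (x ∙ (y ∙ a))))) ≡⟨ cong (λ b → t ∙ (y ∙ (t ∙ b))) (braid ix iy x≁y a) ⟨
        t ∙ (y ∙ (t ∙ (x ∙ (y ∙ (x ∙ a))))) ∎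
      yt≡tyx : ∀ a → y ∙ (t ∙ a) ≡ t ∙ (y ∙ (x ∙ a))
      yt≡tyx a = ∙-cancelˡ x _ _ (trans
        (∙-cancelˡ y _ _ (∙-cancelˡ t _ _ (pyp a))) (commute-past tx (y ∙ (x ∙ a))))
      x≡ty : ∀ a → x ∙ a ≡ t ∙ (y ∙ a)
      x≡ty a = begin
        x ∙ a ≡⟨ yy (x ∙ a) ⟨
        y ∙ (y ∙ (x ∙ a)) ≡⟨ cong (y ∙_) (tt (y ∙ (x ∙ a))) ⟨
        y ∙ (t ∙ (t ∙ (y ∙ (x ∙ a)))) ≡⟨ cong (λ b → y ∙ (t ∙ b)) (yt≡tyx a) ⟨
        y ∙ (t ∙ (y ∙ (t ∙ a))) ≡⟨ braid it iy t≁y (t ∙ a) ⟨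
        t ∙ (y ∙ (t ∙ (t ∙ a))) ≡⟨ cong (λ b → t ∙ (y ∙ b)) (tt a) ⟩
        t ∙ (y ∙ a) ∎

    square-trivial : ∀ {g} → Commute g x → Commute g y → g ∙ g ≡ ε → g ≡ ε
    square-trivial {g} gx gy g² with g ≟ ε
    ... | yes g≡ε = g≡ε
    ... | no  g≢ε = contradiction gy (no-central-involution (g≢ε , g²) gx)

    -- On the vectors v killed by 1 + g + g² and by 1 + x y + y x, the square of the connection
    -- set {x g, x g⁻¹, y} acts as 3.
    cube-trivial : ∀ {g} → Commute g x → Commute g y → (∀ a → g ∙ (g ∙ (g ∙ a)) ≡ a) → g ≡ ε
    cube-trivial {g} gx gy g³ with g ≟ ε
    ... | yes g≡ε = g≡ε
    ... | no  g≢ε = contradiction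
        (trans (sym (shiftSum²≡3⇒zero cayleyIntegral
          ((x₁≢x₂ ∷ x₁≢y ∷ []) ∷ (x₂≢y ∷ []) ∷ [] ∷ []) ε∉ closed v v-eigen ε)) v-ε)
        (0≢1+δ (g ∙ r ε))
      where
      x₁ x₂ : Element
      x₁ = x ∙ g
      x₂ = x ∙ (g ∙ g)
      g-past-x : ∀ a → g ∙ (x ∙ a) ≡ x ∙ (g ∙ a)
      g-past-x = commute-past gx
      g-past-y : ∀ a → g ∙ (y ∙ a) ≡ y ∙ (g ∙ a)
      g-past-y = commute-past gy
      x₁≢x₂ : x₁ ≢ x₂
      x₁≢x₂ eq = g≢ε (sym (∙-cancelˡ g ε g (trans (identityʳ g) (∙-cancelˡ x g (g ∙ g) eq))))
      x₁≢y : x₁ ≢ y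
      x₁≢y eq = x≁y (sym (subst (λ h → Commute h x) eq (commute-∙ refl gx)))
      x₂≢y : x₂ ≢ y
      x₂≢y eq = x≁y (sym (subst (λ h → Commute h x) eq (commute-∙ refl (commute-∙ gx gx))))
      ε∉ : ε ∉ x₁ ∷ x₂ ∷ y ∷ []
      ε∉ (here eq) = x≁y (subst (λ h → Commute h y)
        (trans (inverseʳ-unique x g (sym eq)) (self-inverse (proj₂ ix))) gy)
      ε∉ (there (here eq)) = x≁y (subst (λ h → Commute h y)
        (trans (inverseʳ-unique x (g ∙ g) (sym eq)) (self-inverse (proj₂ ix))) (commute-∙ gy gy))
      ε∉ (there (there (here eq))) = proj₁ iy (sym eq)
      x₁∙ : ∀ a → x₁ ∙ a ≡ x ∙ (g ∙ a)
      x₁∙ a = assoc x g a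
      x₂∙ : ∀ a → x₂ ∙ a ≡ x ∙ (g ∙ (g ∙ a))
      x₂∙ a = trans (assoc x (g ∙ g) a) (cong (x ∙_) (assoc g g a))
      xgx : ∀ a → x ∙ (g ∙ (x ∙ a)) ≡ g ∙ a
      xgx a = trans (cong (x ∙_) (g-past-x a)) (xx (g ∙ a))
      xggx : ∀ a → x ∙ (g ∙ (g ∙ (x ∙ a))) ≡ g ∙ (g ∙ a)
      xggx a = trans (cong (λ b → x ∙ (g ∙ b)) (g-past-x a)) (xgx (g ∙ a))
      x₁x₁ : ∀ a → x₁ ∙ (x₁ ∙ a) ≡ g ∙ (g ∙ a)
      x₁x₁ a = trans (trans (x₁∙ _) (cong (λ b → x ∙ (g ∙ b)) (x₁∙ a))) (xgx (g ∙ a))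
      x₁x₂ : ∀ a → x₁ ∙ (x₂ ∙ a) ≡ a
      x₁x₂ a = trans (trans (x₁∙ _) (cong (λ b → x ∙ (g ∙ b)) (x₂∙ a))) (trans (xgx (g ∙ (g ∙ a))) (g³ a))
      x₂x₁ : ∀ a → x₂ ∙ (x₁ ∙ a) ≡ a
      x₂x₁ a = trans (trans (x₂∙ _) (cong (λ b → x ∙ (g ∙ (g ∙ b))) (x₁∙ a))) (trans (xggx (g ∙ a)) (g³ a))
      x₂x₂ : ∀ a → x₂ ∙ (x₂ ∙ a) ≡ g ∙ a
      x₂x₂ a = trans (trans (x₂∙ _) (cong (λ b → x ∙ (g ∙ (g ∙ b))) (x₂∙ a)))
        (trans (xggx (g ∙ (g ∙ a))) (cong (g ∙_) (g³ a)))
      x₂≡x₁⁻¹ : x₂ ≡ x₁ ⁻¹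
      x₂≡x₁⁻¹ = inverseʳ-unique x₁ x₂ (trans (cong (x₁ ∙_) (sym (identityʳ x₂))) (x₁x₂ ε))
      closed : InverseClosed (x₁ ∷ x₂ ∷ y ∷ [])
      closed (here refl) = there (here (sym x₂≡x₁⁻¹))
      closed (there (here refl)) = here (trans (cong _⁻¹ x₂≡x₁⁻¹) (⁻¹-involutive x₁))
      closed (there (there (here refl))) = there (there (here (self-inverse (proj₂ iy))))
      r : Element → Element
      r a = x ∙ (y ∙ a)
      g-past-r : ∀ a → g ∙ r a ≡ r (g ∙ a)
      g-past-r a = trans (g-past-x (y ∙ a)) (cong (x ∙_) (g-past-y a))
      r² : ∀ a → r (r a) ≡ y ∙ (x ∙ a)
      r² a = trans (cong (λ b → x ∙ (y ∙ (x ∙ (y ∙ b)))) (trans (sym (xx a)) (cong (x ∙_) (sym (yy (x ∙ a))))))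
        (cube (y ∙ (x ∙ a)))
      -- `v` is (1 - g)(1 - r) applied to the indicator of `ε`. As g³ = r³ = 1, such differences are
      -- killed by 1 + g + g² and by 1 + r + r², and r² is y x.
      u v : Element → ℤ
      u a = δ ε a - δ ε (g ∙ a)
      v a = u a - u (r a)
      u-g : ∀ a → (u a + u (g ∙ a)) + u (g ∙ (g ∙ a)) ≡ 0ℤ
      u-g a = trans (cong (λ b → (u a + u (g ∙ a)) + (δ ε (g ∙ (g ∙ a)) - δ ε b)) (g³ a))
        (ring (δ ε a) (δ ε (g ∙ a)) (δ ε (g ∙ (g ∙ a))))
        where
        ring : ∀ p q s → ((p - q) + (q - s)) + (s - p) ≡ 0ℤ
        ring = solve-∀
      v-g : ∀ a → (v a + v (g ∙ a)) + v (g ∙ (g ∙ a)) ≡ 0ℤ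
      v-g a = begin
        (v a + v (g ∙ a)) + v (g ∙ (g ∙ a))
          ≡⟨ cong₂ (λ b c → (v a + (u (g ∙ a) - u b)) + (u (g ∙ (g ∙ a)) - u c))
               (sym (g-past-r a)) (sym (trans (cong (g ∙_) (g-past-r a)) (g-past-r (g ∙ a)))) ⟩
        ((u a - u (r a)) + (u (g ∙ a) - u (g ∙ r a))) + (u (g ∙ (g ∙ a)) - u (g ∙ (g ∙ r a)))
          ≡⟨ ring (u a) (u (g ∙ a)) (u (g ∙ (g ∙ a))) (u (r a)) (u (g ∙ r a)) (u (g ∙ (g ∙ r a))) ⟩
        ((u a + u (g ∙ a)) + u (g ∙ (g ∙ a))) - ((u (r a) + u (g ∙ r a)) + u (g ∙ (g ∙ r a)))
          ≡⟨ cong₂ _-_ (u-g a) (u-g (r a)) ⟩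
        0ℤ ∎
        where
        ring : ∀ p q s p' q' s' → ((p - p') + (q - q')) + (s - s') ≡ ((p + q) + s) - ((p' + q') + s')
        ring = solve-∀
      v-r : ∀ a → (v a + v (r a)) + v (y ∙ (x ∙ a)) ≡ 0ℤ
      v-r a = begin
        (v a + v (r a)) + v (y ∙ (x ∙ a))
          ≡⟨ cong₂ (λ b c → (v a + (u (r a) - u b)) + (u (y ∙ (x ∙ a)) - u c))
               (r² a) (trans (cong (x ∙_) (yy (x ∙ a))) (xx a)) ⟩
        ((u a - u (r a)) + (u (r a) - u (y ∙ (x ∙ a)))) + (u (y ∙ (x ∙ a)) - u a)
          ≡⟨ ring (u a) (u (r a)) (u (y ∙ (x ∙ a))) ⟩
        0ℤ ∎
        where
        ring : ∀ p q s → ((p - q) + (q - s)) + (s - p) ≡ 0ℤ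
        ring = solve-∀
      v-eigen : ∀ a → shiftSum (x₁ ∷ x₂ ∷ y ∷ []) (shiftSum (x₁ ∷ x₂ ∷ y ∷ []) v) a ≡ pos 3 * v a
      v-eigen a = begin
        shiftSum (x₁ ∷ x₂ ∷ y ∷ []) (shiftSum (x₁ ∷ x₂ ∷ y ∷ []) v) a
          ≡⟨ sum₃-cong
               (sum₃-cong (cong v (x₁x₁ a)) (cong v (x₂x₁ a)) (cong v yx₁))
               (sum₃-cong (cong v (x₁x₂ a)) (cong v (x₂x₂ a)) (cong v yx₂))
               (sum₃-cong (cong v x₁y) (cong v x₂y) (cong v (yy a))) ⟩
        sum₃ (sum₃ (v (g ∙ (g ∙ a))) (v a) (v (g ∙ b)))
             (sum₃ (v a) (v (g ∙ a)) (v (g ∙ (g ∙ b))))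
             (sum₃ (v (g ∙ c)) (v (g ∙ (g ∙ c))) (v a))
          ≡⟨ ring (v a) (v (g ∙ a)) (v (g ∙ (g ∙ a))) (v b) (v (g ∙ b)) (v (g ∙ (g ∙ b))) (v c) (v (g ∙ c)) (v (g ∙ (g ∙ c))) ⟩
        -- The cross terms are completed to full orbits of g through a, b and c; the excess a + b +
        -- c that is subtracted again is an orbit of the rotation r.
        pos 3 * v a + ((((v a + v (g ∙ a)) + v (g ∙ (g ∙ a))) + ((v b + v (g ∙ b)) + v (g ∙ (g ∙ b))))
          + (((v c + v (g ∙ c)) + v (g ∙ (g ∙ c))) - ((v a + v c) + v b)))
          ≡⟨ cong (pos 3 * v a +_) (cong₂ _+_ (cong₂ _+_ (v-g a) (v-g b)) (cong₂ _-_ (v-g c) (v-r a))) ⟩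
        pos 3 * v a + 0ℤ ≡⟨ ℤ.+-identityʳ (pos 3 * v a) ⟩
        pos 3 * v a ∎
        where
        b c : Element
        b = y ∙ (x ∙ a)
        c = x ∙ (y ∙ a)
        yx₁ : y ∙ (x₁ ∙ a) ≡ g ∙ b
        yx₁ = trans (cong (y ∙_) (x₁∙ a)) (sym (trans (g-past-y (x ∙ a)) (cong (y ∙_) (g-past-x a))))
        yx₂ : y ∙ (x₂ ∙ a) ≡ g ∙ (g ∙ b)
        yx₂ = trans (cong (y ∙_) (x₂∙ a)) (sym (trans
          (cong (g ∙_) (trans (g-past-y (x ∙ a)) (cong (y ∙_) (g-past-x a))))
          (trans (g-past-y (x ∙ (g ∙ a))) (cong (y ∙_) (g-past-x (g ∙ a))))))
        x₁y : x₁ ∙ (y ∙ a) ≡ g ∙ c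
        x₁y = trans (x₁∙ (y ∙ a)) (sym (g-past-x (y ∙ a)))
        x₂y : x₂ ∙ (y ∙ a) ≡ g ∙ (g ∙ c)
        x₂y = trans (x₂∙ (y ∙ a)) (sym (trans (cong (g ∙_) (g-past-x (y ∙ a))) (g-past-x (g ∙ (y ∙ a)))))
        ring : ∀ a ga gga b gb ggb c gc ggc →
          (gga + (a + (gb + 0ℤ))) + ((a + (ga + (ggb + 0ℤ))) + ((gc + (ggc + (a + 0ℤ))) + 0ℤ)) ≡
          pos 3 * a + ((((a + ga) + gga) + ((b + gb) + ggb)) + (((c + gc) + ggc) - ((a + c) + b)))
        ring = solve-∀
      r-ε : r ε ≢ ε
      r-ε eq = x≁y (cong₂ _∙_ x≡y (sym x≡y))
        where
        x≡y : x ≡ y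
        x≡y = trans (inverseˡ-unique x y (trans (cong (x ∙_) (sym (identityʳ y))) eq)) (self-inverse (proj₂ iy))
      v-ε : v ε ≡ 1ℤ + δ ε (g ∙ r ε)
      v-ε = trans (cong₂ (λ s t → (s - t) - (δ ε (r ε) - δ ε (g ∙ r ε))) (δ-refl ε)
          (δ-≢ λ eq → g≢ε (trans (sym (identityʳ g)) (sym eq))))
        (trans (cong (λ s → (1ℤ - 0ℤ) - (s - δ ε (g ∙ r ε))) (δ-≢ (r-ε ∘ sym))) (ring (δ ε (g ∙ r ε))))
        where
        ring : ∀ s → (1ℤ - 0ℤ) - (0ℤ - s) ≡ 1ℤ + s
        ring = solve-∀

    -- If g² ≠ ε, the connection set {g, g⁻¹} gives g⁴ = ε or g⁻⁶ = ε. In the first case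
    -- `square-trivial` applies to g² and then to g; in the second it gives g⁻³ = ε, and
    -- `cube-trivial` finishes.
    centralizer-trivial : ∀ {g} → Commute g x → Commute g y → g ≡ ε
    centralizer-trivial {g} gx gy with g ∙ g ≟ ε
    ... | yes g²≡ε = square-trivial gx gy g²≡ε
    ... | no  g²≢ε with five-steps cayleyIntegral g≢ε g⁻¹≢ε g≢g⁻¹ closed (iterate g) (iterate (g ⁻¹))
            (λ a → refl) (λ a → refl) (λ a → refl) (λ a → refl) step
      where
      g≢ε : g ≢ ε
      g≢ε refl = g²≢ε (identityˡ ε)
      g≢g⁻¹ : g ≢ g ⁻¹
      g≢g⁻¹ eq = g²≢ε (trans (cong (g ∙_) eq) (inverseʳ g))
      g⁻¹≢ε : g ⁻¹ ≢ ε
      g⁻¹≢ε eq = g≢ε (trans (sym (identityʳ g)) (trans (cong (g ∙_) (sym eq)) (inverseʳ g)))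
      closed : InverseClosed (g ∷ g ⁻¹ ∷ [])
      closed (here refl)         = there (here refl)
      closed (there (here refl)) = here (⁻¹-involutive g)
      step : ∀ k (v : Element → ℤ) a →
        (v (iterate g (suc k) (g ∙ a)) + v (iterate (g ⁻¹) (suc k) (g ∙ a))) +
        (v (iterate g (suc k) (g ⁻¹ ∙ a)) + v (iterate (g ⁻¹) (suc k) (g ⁻¹ ∙ a))) ≡
        (v (iterate g (suc (suc k)) a) + v (iterate (g ⁻¹) (suc (suc k)) a)) +
        (v (iterate g k a) + v (iterate (g ⁻¹) k a))
      step k v a = begin
        (s + v (iterate (g ⁻¹) k (g ⁻¹ ∙ (g ∙ a)))) + (v (iterate g k (g ∙ (g ⁻¹ ∙ a))) + t)
          ≡⟨ cong₂ (λ b c → (s + v (iterate (g ⁻¹) k b)) + (v (iterate g k c) + t))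
               (\\-leftDividesʳ g a) (\\-leftDividesˡ g a) ⟩
        (s + v (iterate (g ⁻¹) k a)) + (v (iterate g k a) + t)
          ≡⟨ ring s (v (iterate (g ⁻¹) k a)) (v (iterate g k a)) t ⟩
        (s + t) + (v (iterate g k a) + v (iterate (g ⁻¹) k a)) ∎
        where
        s t : ℤ
        s = v (iterate g (suc (suc k)) a)
        t = v (iterate (g ⁻¹) (suc (suc k)) a)
        ring : ∀ s u w t → (s + u) + (w + t) ≡ (s + t) + (w + u)
        ring = solve-∀
    ... | inj₁ g⁴≡ε = square-trivial gx gy (square-trivial (commute-∙ gx gx) (commute-∙ gy gy)
      (trans (assoc g g (g ∙ g)) (trans (cong (λ b → g ∙ (g ∙ (g ∙ b))) (trans (sym (identityʳ g)) (cong (g ∙_) (sym (inverseʳ g)))))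
        g⁴≡ε)))
    ... | inj₂ k⁶≡ε = trans (sym (identityʳ g)) (trans (cong (g ∙_) (sym k≡ε)) (inverseʳ g))
      where
      k : Element
      k = g ⁻¹
      inverse-commute : ∀ {h} → Commute g h → Commute k h
      inverse-commute {h} gh = begin
        k ∙ h ≡⟨ cong (k ∙_) (trans (cong (h ∙_) (inverseʳ g)) (identityʳ h)) ⟨
        k ∙ (h ∙ (g ∙ k)) ≡⟨ cong (k ∙_) (commute-past gh k) ⟨
        k ∙ (g ∙ (h ∙ k)) ≡⟨ \\-leftDividesʳ g (h ∙ k) ⟩
        h ∙ k ∎
      kx : Commute k x
      kx = inverse-commute gx
      ky : Commute k y
      ky = inverse-commute gy
      k³≡ε : k ∙ (k ∙ k) ≡ ε
      k³≡ε = square-trivial (commute-∙ kx (commute-∙ kx kx)) (commute-∙ ky (commute-∙ ky ky))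
        (trans (assoc k (k ∙ k) _) (trans (cong (k ∙_) (assoc k k _)) k⁶≡ε))
      k≡ε : k ≡ ε
      k≡ε = cube-trivial kx ky (act≡ε⇒fixes (k ∷ k ∷ k ∷ [])
        (trans (cong (λ b → k ∙ (k ∙ b)) (identityʳ k)) k³≡ε))

  -- Exclusion of a fourth involution

  module InvolutionsOfS₃ {x y : Element} (ix : Involution x) (iy : Involution y) (x≁y : ¬ Commute x y) where

    private
      xx : ∀ a → x ∙ (x ∙ a) ≡ a
      xx = cancel-square (proj₂ ix)
      yy : ∀ a → y ∙ (y ∙ a) ≡ a
      yy = cancel-square (proj₂ iy)

    z : Element
    z = x ∙ (y ∙ x)

    z∙ : ∀ a → z ∙ a ≡ x ∙ (y ∙ (x ∙ a))
    z∙ a = trans (assoc x (y ∙ x) a) (cong (x ∙_) (assoc y x a))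

    iz : Involution z
    iz = (λ eq → proj₁ iy (∙-cancelʳ x y ε (trans (trans (inverseʳ-unique x (y ∙ x) eq) (self-inverse (proj₂ ix))) (sym (identityˡ x)))))
       , trans (z∙ z) (trans (cong (λ b → x ∙ (y ∙ b)) (xx (y ∙ x))) (trans (cong (x ∙_) (yy x)) (proj₂ ix)))

    z≁x : ¬ Commute z x
    z≁x eq = x≁y (begin
      x ∙ y ≡⟨ cong (x ∙_) (trans (cong (y ∙_) (proj₂ ix)) (identityʳ y)) ⟨
      x ∙ (y ∙ (x ∙ x)) ≡⟨ z∙ x ⟨
      z ∙ x ≡⟨ eq ⟩
      x ∙ z ≡⟨ xx (y ∙ x) ⟩
      y ∙ x ∎)

    product≡ε : ∀ {g h} → h ∙ h ≡ ε → g ∙ (h ∙ ε) ≡ ε → g ≡ h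
    product≡ε {g} {h} h² eq =
      trans (inverseˡ-unique g h (trans (cong (g ∙_) (sym (identityʳ h))) eq)) (self-inverse h²)

    -- The rotations r = x y and s = x t commute, since their commutator c centralizes x and y. On the
    -- vectors v with r v = v that are killed by 1 + s + s², the square of {x, y, t} acts as 3.
    module FourthInvolution {t : Element} (it : Involution t) (t≢x : t ≢ x) (t≢y : t ≢ y) (t≢z : t ≢ z) where
      tt : ∀ a → t ∙ (t ∙ a) ≡ a
      tt = cancel-square (proj₂ it)

      r r⁻ s s⁻ : Element → Element
      r a = x ∙ (y ∙ a)
      r⁻ a = y ∙ (x ∙ a)
      s a = x ∙ (t ∙ a)
      s⁻ a = t ∙ (x ∙ a)

      rr⁻ : ∀ a → r (r⁻ a) ≡ a
      rr⁻ a = trans (cong (x ∙_) (yy (x ∙ a))) (xx a)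
      r⁻r : ∀ a → r⁻ (r a) ≡ a
      r⁻r a = trans (cong (y ∙_) (xx (y ∙ a))) (yy a)
      ss⁻ : ∀ a → s (s⁻ a) ≡ a
      ss⁻ a = trans (cong (x ∙_) (tt (x ∙ a))) (xx a)
      s⁻s : ∀ a → s⁻ (s a) ≡ a
      s⁻s a = trans (cong (t ∙_) (xx (t ∙ a))) (tt a)

      rr : ∀ a → r (r a) ≡ r⁻ a
      rr a = trans (cong (r ∘ r) (sym (rr⁻ a))) (involutions-cube ix iy x≁y (r⁻ a))
      ss : ∀ a → s (s a) ≡ s⁻ a
      ss a = trans (cong (s ∘ s) (sym (ss⁻ a)))
        (involutions-cube ix it (t≢x ∘ commuting-involution ix iy x≁y it ∘ sym) (s⁻ a))
      s⁻s⁻ : ∀ a → s⁻ (s⁻ a) ≡ s a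
      s⁻s⁻ a = trans (cong s⁻ (sym (ss a))) (s⁻s (s a))

      -- r s is multiplication by z t, and r⁻ s below is multiplication by y t. By
      -- `commuting-involution`, `t` commutes with neither `z` nor `y`, so both products have order
      -- 3.
      rs-cube : ∀ a → r (s (r (s (r (s a))))) ≡ a
      rs-cube a = begin
        r (s (r (s (r (s a))))) ≡⟨ trans (z∙ _) (cong (r ∘ s) (trans (z∙ _) (cong (r ∘ s) (z∙ (t ∙ a))))) ⟨
        z ∙ (t ∙ (z ∙ (t ∙ (z ∙ (t ∙ a))))) ≡⟨ involutions-cube iz it (t≢z ∘ commuting-involution iz ix z≁x it ∘ sym) a ⟩
        a ∎

      r⁻s-cube : ∀ a → r⁻ (s (r⁻ (s (r⁻ (s a))))) ≡ a
      r⁻s-cube a = trans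
        (trans (r⁻s _) (cong (λ b → y ∙ (t ∙ b)) (trans (r⁻s _) (cong (λ b → y ∙ (t ∙ b)) (r⁻s a)))))
        (involutions-cube iy it (t≢y ∘ commuting-involution iy ix (x≁y ∘ sym) it ∘ sym) a)
        where
        r⁻s : ∀ a → r⁻ (s a) ≡ y ∙ (t ∙ a)
        r⁻s a = cong (y ∙_) (xx (t ∙ a))

      srs : ∀ a → s (r (s a)) ≡ r⁻ (s⁻ (r⁻ a))
      srs = cube⇒swap {f = r} {r⁻} {s} {s⁻} r⁻r s⁻s rs-cube
      sr⁻s : ∀ a → s (r⁻ (s a)) ≡ r (s⁻ (r a))
      sr⁻s = cube⇒swap {f = r⁻} {r} {s} {s⁻} rr⁻ s⁻s r⁻s-cube
      s⁻r⁻s⁻ : ∀ a → s⁻ (r⁻ (s⁻ a)) ≡ r (s (r a))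
      s⁻r⁻s⁻ = swap-inverse {f = r} {r⁻} {s} {s⁻} r⁻r s⁻s srs
      s⁻rs⁻ : ∀ a → s⁻ (r (s⁻ a)) ≡ r⁻ (s (r⁻ a))
      s⁻rs⁻ = swap-inverse {f = r⁻} {r} {s} {s⁻} rr⁻ s⁻s sr⁻s

      -- The commutator of r and s. The relations r³ = s³ = (r s)³ = (r⁻ s)³ = 1 present the
      -- nonabelian group of order 27 and exponent 3, where commutators are central; hence
      -- `c-past-r`.
      c : Element → Element
      c a = r (s (r⁻ (s⁻ a)))

      c-alternative : ∀ a → c a ≡ r⁻ (s⁻ (r (s a)))
      c-alternative a = begin
        r (s (r⁻ (s⁻ a)))    ≡⟨ cong (r ∘ s ∘ r⁻) (ss a) ⟨
        r (s (r⁻ (s (s a)))) ≡⟨ cong r (sr⁻s (s a)) ⟩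
        r (r (s⁻ (r (s a)))) ≡⟨ rr _ ⟩
        r⁻ (s⁻ (r (s a)))    ∎

      -- `x` inverts r and s, so it conjugates c to r⁻ s⁻ r s, which is c again by `c-alternative`.
      c-past-x : ∀ a → c (x ∙ a) ≡ x ∙ c a
      c-past-x a = sym (begin
        x ∙ r (s (r⁻ (s⁻ a)))    ≡⟨ xr _ ⟩
        r⁻ (x ∙ s (r⁻ (s⁻ a)))   ≡⟨ cong r⁻ (xs _) ⟩
        r⁻ (s⁻ (r (s (x ∙ a))))  ≡⟨ c-alternative (x ∙ a) ⟨
        c (x ∙ a)                ∎)
        where
        xr : ∀ a → x ∙ r a ≡ r⁻ (x ∙ a)
        xr a = trans (xx (y ∙ a)) (cong (y ∙_) (sym (xx a)))
        xs : ∀ a → x ∙ s a ≡ s⁻ (x ∙ a)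
        xs a = trans (xx (t ∙ a)) (cong (t ∙_) (sym (xx a)))

      c-past-r : ∀ a → c (r a) ≡ r (c a)
      c-past-r a = begin
        c (r a)                   ≡⟨ c-alternative (r a) ⟩
        r⁻ (s⁻ (r (s (r a))))     ≡⟨ cong (r⁻ ∘ s⁻) (s⁻r⁻s⁻ a) ⟨
        r⁻ (s⁻ (s⁻ (r⁻ (s⁻ a))))  ≡⟨ cong r⁻ (s⁻s⁻ _) ⟩
        r⁻ (s (r⁻ (s⁻ a)))        ≡⟨ s⁻rs⁻ (s⁻ a) ⟨
        s⁻ (r (s⁻ (s⁻ a)))        ≡⟨ cong (s⁻ ∘ r) (s⁻s⁻ a) ⟩
        s⁻ (r (s a))              ≡⟨ rr⁻ _ ⟨
        r (r⁻ (s⁻ (r (s a))))     ≡⟨ cong r (c-alternative a) ⟨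
        r (c a)                   ∎

      c-past-y : ∀ a → c (y ∙ a) ≡ y ∙ c a
      c-past-y a = begin
        c (y ∙ a)      ≡⟨ cong c (xx (y ∙ a)) ⟨
        c (x ∙ r a)    ≡⟨ c-past-x (r a) ⟩
        x ∙ c (r a)    ≡⟨ cong (x ∙_) (c-past-r a) ⟩
        x ∙ r (c a)    ≡⟨ xx (y ∙ c a) ⟩
        y ∙ c a        ∎

      c-trivial : ∀ a → c a ≡ a
      c-trivial = act≡ε⇒fixes letters (centralizer-trivial ix iy x≁y
        (past-commute λ a → trans (c∙ (x ∙ a)) (trans (c-past-x a) (cong (x ∙_) (sym (c∙ a)))))
        (past-commute λ a → trans (c∙ (y ∙ a)) (trans (c-past-y a) (cong (y ∙_) (sym (c∙ a))))))
        where
        letters : List Element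
        letters = x ∷ y ∷ x ∷ t ∷ y ∷ x ∷ t ∷ x ∷ []
        c∙ : ∀ a → act letters ε ∙ a ≡ c a
        c∙ = act-assoc letters

      rs≡sr : ∀ a → r (s a) ≡ s (r a)
      rs≡sr a = begin
        r (s a)                   ≡⟨ cong (r ∘ s) (trans (cong r⁻ (s⁻s (r a))) (r⁻r a)) ⟨
        c (s (r a))               ≡⟨ c-trivial (s (r a)) ⟩
        s (r a)                   ∎

      generators : List Element
      generators = x ∷ y ∷ t ∷ []

      module _ (v : Element → ℤ) (v-r : ∀ a → v (r a) ≡ v a) (v-s : ∀ a → (v a + v (s a)) + v (s⁻ a) ≡ 0ℤ) where
        v-r⁻ : ∀ a → v (r⁻ a) ≡ v a
        v-r⁻ a = trans (sym (v-r (r⁻ a))) (cong v (rr⁻ a))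

        shiftSum²≡3 : ∀ a → shiftSum generators (shiftSum generators v) a ≡ pos 3 * v a
        shiftSum²≡3 a = begin
          shiftSum generators (shiftSum generators v) a
            ≡⟨ sum₃-cong
                 (sum₃-cong (cong v (xx a)) (v-r⁻ a) (refl {x = v (s⁻ a)}))
                 (sum₃-cong (v-r a) (cong v (yy a)) v-ty)
                 (sum₃-cong (refl {x = v (s a)}) v-yt (cong v (tt a))) ⟩
          sum₃ (sum₃ (v a) (v a) (v (s⁻ a))) (sum₃ (v a) (v a) (v (s⁻ a))) (sum₃ (v (s a)) (v (s a)) (v a))
            ≡⟨ ring (v a) (v (s a)) (v (s⁻ a)) ⟩
          pos 3 * v a + pos 2 * ((v a + v (s a)) + v (s⁻ a)) ≡⟨ cong (λ q → pos 3 * v a + pos 2 * q) (v-s a) ⟩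
          pos 3 * v a + 0ℤ ≡⟨ ℤ.+-identityʳ (pos 3 * v a) ⟩
          pos 3 * v a ∎
          where
          -- t y is s⁻ r; since r and s commute, r can be moved outermost, where the invariance of
          -- `v` absorbs it.
          v-ty : v (t ∙ (y ∙ a)) ≡ v (s⁻ a)
          v-ty = trans (cong v (begin
            t ∙ (y ∙ a) ≡⟨ cong (t ∙_) (xx (y ∙ a)) ⟨
            s⁻ (r a)    ≡⟨ ss (r a) ⟨
            s (s (r a)) ≡⟨ trans (rs≡sr (s a)) (cong s (rs≡sr a)) ⟨
            r (s (s a)) ≡⟨ cong r (ss a) ⟩
            r (s⁻ a)    ∎)) (v-r (s⁻ a))
          v-yt : v (y ∙ (t ∙ a)) ≡ v (s a)
          v-yt = trans (cong (λ b → v (y ∙ b)) (sym (xx (t ∙ a)))) (v-r⁻ (s a))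
          ring : ∀ p q q' → (p + (p + (q' + 0ℤ))) + ((p + (p + (q' + 0ℤ))) + ((q + (q + (p + 0ℤ))) + 0ℤ)) ≡
            pos 3 * p + pos 2 * ((p + q) + q')
          ring = solve-∀

      module _ (e : Element → ℤ) where
        difference-s : ∀ a → ((e a - e (s a)) + (e (s a) - e (s (s a)))) + (e (s⁻ a) - e (s (s⁻ a))) ≡ 0ℤ
        difference-s a = trans
          (cong₂ (λ b c → ((e a - e (s a)) + (e (s a) - e b)) + (e (s⁻ a) - e c)) (ss a) (ss⁻ a))
          (ring (e a) (e (s a)) (e (s⁻ a)))
          where
          ring : ∀ p q s → ((p - q) + (q - s)) + (s - p) ≡ 0ℤ
          ring = solve-∀

        difference-r : (∀ a → e (r a) ≡ e a) → ∀ a → e (r a) - e (s (r a)) ≡ e a - e (s a)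
        difference-r e-r a = cong₂ _-_ (e-r a) (trans (cong e (sym (rs≡sr a))) (e-r (s a)))

      orbitSum-r : ∀ (d : Element → ℤ) a → d (r a) + (d (r (r a)) + d (r⁻ (r a))) ≡ d a + (d (r a) + d (r⁻ a))
      orbitSum-r d a = trans (cong₂ (λ b c → d (r a) + (d b + d c)) (rr a) (r⁻r a)) (rotate (d (r a)) (d (r⁻ a)) (d a))
        where
        rotate : ∀ p q s → p + (q + s) ≡ s + (p + q)
        rotate = solve-∀

      -- Summing the indicator of `ε` over the powers of r makes `e` invariant under r; applying 1 -
      -- s gives a vector killed by 1 + s + s², still invariant because r and s commute. Its value
      -- at `ε` is 1, since x ≠ y and t differs from x, y and z.
      e v : Element → ℤ
      e a = δ ε a + (δ ε (r a) + δ ε (r⁻ a))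
      v a = e a - e (s a)

      v-ε : v ε ≡ 1ℤ
      v-ε = combine (δ-refl ε)
        (δ-≢ λ eq → x≢y (product≡ε (proj₂ iy) (sym eq)))
        (δ-≢ λ eq → x≢y (sym (product≡ε (proj₂ ix) (sym eq))))
        (δ-≢ λ eq → t≢x (sym (product≡ε (proj₂ it) (sym eq))))
        (δ-≢ λ eq → t≢z (sym (product≡ε (proj₂ it) (trans (z∙ _) (sym eq)))))
        (δ-≢ λ eq → t≢y (sym (product≡ε (proj₂ it) (trans (cong (y ∙_) (sym (xx (t ∙ ε)))) (sym eq)))))
        where
        x≢y : x ≢ y
        x≢y refl = x≁y refl
        combine : ∀ {p q q' u w w'} → p ≡ 1ℤ → q ≡ 0ℤ → q' ≡ 0ℤ → u ≡ 0ℤ → w ≡ 0ℤ → w' ≡ 0ℤ →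
          (p + (q + q')) - (u + (w + w')) ≡ 1ℤ
        combine refl refl refl refl refl refl = refl

      impossible : ⊥
      impossible = contradiction (trans (sym v-ε) (shiftSum²≡3⇒zero cayleyIntegral unique ε∉ closed v
        (shiftSum²≡3 v (difference-r e (orbitSum-r (δ ε))) (difference-s e)) ε)) λ ()
        where
        unique : Unique generators
        unique = ((λ { refl → x≁y refl }) ∷ (t≢x ∘ sym) ∷ []) ∷ ((t≢y ∘ sym) ∷ []) ∷ [] ∷ []
        ε∉ : ε ∉ generators
        ε∉ (here eq) = proj₁ ix (sym eq)
        ε∉ (there (here eq)) = proj₁ iy (sym eq)
        ε∉ (there (there (here eq))) = proj₁ it (sym eq)
        closed : InverseClosed generators
        closed (here refl) = here (self-inverse (proj₂ ix))
        closed (there (here refl)) = there (here (self-inverse (proj₂ iy)))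
        closed (there (there (here refl))) = there (there (here (self-inverse (proj₂ it))))

    -- The conjugation action on the three involutions

    transposition : Fin 3 → Element
    transposition 0F = x
    transposition 1F = y
    transposition 2F = z

    transposition-involution : ∀ i → Involution (transposition i)
    transposition-involution 0F = ix
    transposition-involution 1F = iy
    transposition-involution 2F = iz

    transposition-complete : ∀ {t} → Involution t → ∃ λ i → t ≡ transposition i
    transposition-complete {t} it with t ≟ x | t ≟ y | t ≟ z
    ... | yes t≡x | _ | _ = 0F , t≡x
    ... | no _ | yes t≡y | _ = 1F , t≡y
    ... | no _ | no _ | yes t≡z = 2F , t≡z
    ... | no t≢x | no t≢y | no t≢z = ⊥-elim (FourthInvolution.impossible it t≢x t≢y t≢z)

    transposition-injective : ∀ {i j} → transposition i ≡ transposition j → i ≡ j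
    transposition-injective {0F} {0F} eq = refl
    transposition-injective {1F} {1F} eq = refl
    transposition-injective {2F} {2F} eq = refl
    transposition-injective {0F} {1F} eq = ⊥-elim (x≁y (cong₂ _∙_ eq (sym eq)))
    transposition-injective {1F} {0F} eq = ⊥-elim (x≁y (cong₂ _∙_ (sym eq) eq))
    transposition-injective {0F} {2F} eq = ⊥-elim (z≁x (cong₂ _∙_ (sym eq) eq))
    transposition-injective {2F} {0F} eq = ⊥-elim (z≁x (cong₂ _∙_ eq (sym eq)))
    transposition-injective {1F} {2F} eq = ⊥-elim (x≁y (trans (cong (x ∙_) eq) (xx (y ∙ x))))
    transposition-injective {2F} {1F} eq = ⊥-elim (x≁y (trans (cong (x ∙_) (sym eq)) (xx (y ∙ x))))

    conjugate : Element → Element → Element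
    conjugate g h = (g ∙ h) ∙ g ⁻¹

    conjugate-∙ : ∀ g h → conjugate g h ∙ g ≡ g ∙ h
    conjugate-∙ g h = trans (assoc (g ∙ h) (g ⁻¹) g) (trans (cong ((g ∙ h) ∙_) (inverseˡ g)) (identityʳ (g ∙ h)))

    conjugate-unique : ∀ {g h k} → k ∙ g ≡ g ∙ h → conjugate g h ≡ k
    conjugate-unique {g} {h} {k} eq = ∙-cancelʳ g _ _ (trans (conjugate-∙ g h) (sym eq))

    conjugate-involution : ∀ g {t} → Involution t → Involution (conjugate g t)
    conjugate-involution g {t} (t≢ε , t²) =
        (λ eq → t≢ε (∙-cancelˡ g t ε (begin
          g ∙ t                ≡⟨ conjugate-∙ g t ⟨
          conjugate g t ∙ g    ≡⟨ cong (_∙ g) eq ⟩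
          ε ∙ g                ≡⟨ trans (identityˡ g) (sym (identityʳ g)) ⟩
          g ∙ ε                ∎)))
      , (begin
          conjugate g t ∙ ((g ∙ t) ∙ g ⁻¹) ≡⟨ assoc (conjugate g t) (g ∙ t) (g ⁻¹) ⟨
          (conjugate g t ∙ (g ∙ t)) ∙ g ⁻¹ ≡⟨ cong (_∙ g ⁻¹) (assoc (conjugate g t) g t) ⟨
          ((conjugate g t ∙ g) ∙ t) ∙ g ⁻¹ ≡⟨ cong (λ b → (b ∙ t) ∙ g ⁻¹) (conjugate-∙ g t) ⟩
          ((g ∙ t) ∙ t) ∙ g ⁻¹             ≡⟨ cong (_∙ g ⁻¹) (trans (assoc g t t) (trans (cong (g ∙_) t²) (identityʳ g))) ⟩
          g ∙ g ⁻¹                         ≡⟨ inverseʳ g ⟩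
          ε                                ∎)

    conjugate-conjugate : ∀ g h k → conjugate (g ∙ h) k ≡ conjugate g (conjugate h k)
    conjugate-conjugate g h k = conjugate-unique (begin
      conjugate g (conjugate h k) ∙ (g ∙ h) ≡⟨ assoc _ g h ⟨
      (conjugate g (conjugate h k) ∙ g) ∙ h ≡⟨ cong (_∙ h) (conjugate-∙ g (conjugate h k)) ⟩
      (g ∙ conjugate h k) ∙ h               ≡⟨ assoc g (conjugate h k) h ⟩
      g ∙ (conjugate h k ∙ h)               ≡⟨ cong (g ∙_) (conjugate-∙ h k) ⟩
      g ∙ (h ∙ k)                           ≡⟨ assoc g h k ⟨
      (g ∙ h) ∙ k                           ∎)

    conjugate-injective : ∀ g {h k} → conjugate g h ≡ conjugate g k → h ≡ k
    conjugate-injective g {h} {k} eq = ∙-cancelˡ g h k (∙-cancelʳ (g ⁻¹) _ _ eq)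

    same-conjugate⇒commute : ∀ {g h k} → conjugate g k ≡ conjugate h k → Commute (h ⁻¹ ∙ g) k
    same-conjugate⇒commute {g} {h} {k} eq = begin
      (h ⁻¹ ∙ g) ∙ k                ≡⟨ assoc (h ⁻¹) g k ⟩
      h ⁻¹ ∙ (g ∙ k)                ≡⟨ cong (h ⁻¹ ∙_) (conjugate-∙ g k) ⟨
      h ⁻¹ ∙ (conjugate g k ∙ g)    ≡⟨ cong (λ b → h ⁻¹ ∙ (b ∙ g)) eq ⟩
      h ⁻¹ ∙ (((h ∙ k) ∙ h ⁻¹) ∙ g) ≡⟨ cong (h ⁻¹ ∙_) (trans (assoc (h ∙ k) (h ⁻¹) g) (assoc h k (h ⁻¹ ∙ g))) ⟩
      h ⁻¹ ∙ (h ∙ (k ∙ (h ⁻¹ ∙ g))) ≡⟨ \\-leftDividesʳ h (k ∙ (h ⁻¹ ∙ g)) ⟩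
      k ∙ (h ⁻¹ ∙ g)                ∎

    permute : Element → Fin 3 → Fin 3
    permute g i = proj₁ (transposition-complete (conjugate-involution g (transposition-involution i)))

    conjugate-transposition : ∀ g i → conjugate g (transposition i) ≡ transposition (permute g i)
    conjugate-transposition g i = proj₂ (transposition-complete (conjugate-involution g (transposition-involution i)))

    permute-injective : ∀ g {i j} → permute g i ≡ permute g j → i ≡ j
    permute-injective g {i} {j} eq = transposition-injective (conjugate-injective g
      (trans (conjugate-transposition g i) (trans (cong transposition eq) (sym (conjugate-transposition g j)))))

    permute-∙ : ∀ g h i → permute (g ∙ h) i ≡ permute g (permute h i)
    permute-∙ g h i = transposition-injective (begin
      transposition (permute (g ∙ h) i)              ≡⟨ conjugate-transposition (g ∙ h) i ⟨
      conjugate (g ∙ h) (transposition i)            ≡⟨ conjugate-conjugate g h (transposition i) ⟩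
      conjugate g (conjugate h (transposition i))    ≡⟨ cong (conjugate g) (conjugate-transposition h i) ⟩
      conjugate g (transposition (permute h i))      ≡⟨ conjugate-transposition g (permute h i) ⟩
      transposition (permute g (permute h i))        ∎)

    -- If g and h act alike, h⁻¹ g centralizes `x` and `y`.
    permute-faithful : ∀ {g h} → (∀ i → permute g i ≡ permute h i) → g ≡ h
    permute-faithful {g} {h} eq = trans
      (inverseʳ-unique (h ⁻¹) g (centralizer-trivial ix iy x≁y (commutes 0F) (commutes 1F))) (⁻¹-involutive h)
      where
      commutes : ∀ i → Commute (h ⁻¹ ∙ g) (transposition i)
      commutes i = same-conjugate⇒commute
        (trans (conjugate-transposition g i) (trans (cong transposition (eq i)) (sym (conjugate-transposition h i))))

    φ : Element → Vec (Fin 3) 3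
    φ g = tabulate (permute g)

    lookup-φ : ∀ g i → lookup (φ g) i ≡ permute g i
    lookup-φ g = lookup∘tabulate (permute g)

    φ-∙ : ∀ g h → φ (g ∙ h) ≡ compose3 G (φ g) (φ h)
    φ-∙ g h = tabulate-cong λ i → trans (permute-∙ g h i)
      (sym (trans (lookup-φ g (lookup (φ h) i)) (cong (permute g) (lookup-φ h i))))

    φ-injective : ∀ {g h} → φ g ≡ φ h → g ≡ h
    φ-injective {g} {h} eq = permute-faithful λ i →
      trans (sym (lookup-φ g i)) (trans (cong (λ σ → lookup σ i) eq) (lookup-φ h i))

    φ-permutation : ∀ g → IsPermutation3 G (φ g)
    φ-permutation g {i} {j} eq = permute-injective g (trans (sym (lookup-φ g i)) (trans eq (lookup-φ g j)))

    -- `permute` is defined through equality tests that do not reduce for variable x and y, so its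
    -- values are identified by the relations that determine them.
    φ-unique : ∀ g σ → (∀ i → transposition (lookup σ i) ∙ g ≡ g ∙ transposition i) → φ g ≡ σ
    φ-unique g σ eq = trans (tabulate-cong same) (tabulate∘lookup σ)
      where
      same : ∀ i → permute g i ≡ lookup σ i
      same i = transposition-injective (trans (sym (conjugate-transposition g i)) (conjugate-unique (eq i)))

    φ-x : φ x ≡ 0F ∷ 2F ∷ 1F ∷ []
    φ-x = φ-unique x _ λ where
      0F → refl
      1F → trans (z∙ x) (cong (x ∙_) (trans (cong (y ∙_) (proj₂ ix)) (identityʳ y)))
      2F → sym (xx (y ∙ x))

    φ-y : φ y ≡ 2F ∷ 1F ∷ 0F ∷ []
    φ-y = φ-unique y _ λ where
        0F → zy≡yx
        1F → refl
        2F → begin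
          x ∙ y             ≡⟨ yy (x ∙ y) ⟨
          y ∙ (y ∙ (x ∙ y)) ≡⟨ cong (λ b → y ∙ (y ∙ (x ∙ b))) (identityʳ y) ⟨
          y ∙ (y ∙ (x ∙ (y ∙ ε))) ≡⟨ cong (y ∙_) (braid ix iy x≁y ε) ⟨
          y ∙ (x ∙ (y ∙ (x ∙ ε))) ≡⟨ cong (λ b → y ∙ (x ∙ (y ∙ b))) (identityʳ x) ⟩
          y ∙ z             ∎
      where
      zy≡yx : z ∙ y ≡ y ∙ x
      zy≡yx = trans (z∙ y) (trans (braid ix iy x≁y y)
        (cong (y ∙_) (trans (cong (x ∙_) (proj₂ iy)) (identityʳ x))))

    φ-product : ∀ {g h σ τ} → φ g ≡ σ → φ h ≡ τ → φ (g ∙ h) ≡ compose3 G σ τ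
    φ-product {g} {h} refl refl = φ-∙ g h

    φ-surjective : ∀ σ → IsPermutation3 G σ → ∃ λ g → φ g ≡ σ
    φ-surjective (0F ∷ 1F ∷ 2F ∷ []) p = x ∙ x , φ-product φ-x φ-x
    φ-surjective (0F ∷ 2F ∷ 1F ∷ []) p = x , φ-x
    φ-surjective (1F ∷ 0F ∷ 2F ∷ []) p = x ∙ (y ∙ x) , φ-product φ-x (φ-product φ-y φ-x)
    φ-surjective (1F ∷ 2F ∷ 0F ∷ []) p = x ∙ y , φ-product φ-x φ-y
    φ-surjective (2F ∷ 0F ∷ 1F ∷ []) p = y ∙ x , φ-product φ-y φ-x
    φ-surjective (2F ∷ 1F ∷ 0F ∷ []) p = y , φ-y
    φ-surjective (0F ∷ 0F ∷ _ ∷ []) p = contradiction (p {0F} {1F} refl) λ ()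
    φ-surjective (1F ∷ 1F ∷ _ ∷ []) p = contradiction (p {0F} {1F} refl) λ ()
    φ-surjective (2F ∷ 2F ∷ _ ∷ []) p = contradiction (p {0F} {1F} refl) λ ()
    φ-surjective (0F ∷ _ ∷ 0F ∷ []) p = contradiction (p {0F} {2F} refl) λ ()
    φ-surjective (1F ∷ _ ∷ 1F ∷ []) p = contradiction (p {0F} {2F} refl) λ ()
    φ-surjective (2F ∷ _ ∷ 2F ∷ []) p = contradiction (p {0F} {2F} refl) λ ()
    φ-surjective (_ ∷ 0F ∷ 0F ∷ []) p = contradiction (p {1F} {2F} refl) λ ()
    φ-surjective (_ ∷ 1F ∷ 1F ∷ []) p = contradiction (p {1F} {2F} refl) λ ()
    φ-surjective (_ ∷ 2F ∷ 2F ∷ []) p = contradiction (p {1F} {2F} refl) λ ()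

    isomorphism : IsomorphicToS3 G
    isomorphism = φ , φ-permutation , φ-∙ , φ-injective , φ-surjective

-- The converse: two transpositions pulled back from S₃

S₃⇒nonCommutingInvolutions : (G : FiniteGroup) → IsomorphicToS3 G → HasNonCommutingInvolutions G
S₃⇒nonCommutingInvolutions G (φ , _ , φ-∙ , φ-injective , φ-surjective) =
  proj₁ a , proj₁ b , (≢ε a (λ ()) , square a refl) , (≢ε b (λ ()) , square b refl) , non-commuting
  where
  open CayleyGraph G
  identity σ τ : Vec (Fin 3) 3
  identity = 0F ∷ 1F ∷ 2F ∷ []
  σ = 1F ∷ 0F ∷ 2F ∷ []
  τ = 0F ∷ 2F ∷ 1F ∷ []
  Preimage : Vec (Fin 3) 3 → Set
  Preimage ρ = ∃ λ g → φ g ≡ ρ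
  involution-preimage : ∀ ρ → (∀ i → lookup ρ (lookup ρ i) ≡ i) → Preimage ρ
  involution-preimage ρ involutive = φ-surjective ρ λ {i} {j} eq →
    trans (sym (involutive i)) (trans (cong (lookup ρ) eq) (involutive j))
  a : Preimage σ
  a = involution-preimage σ λ { 0F → refl ; 1F → refl ; 2F → refl }
  b : Preimage τ
  b = involution-preimage τ λ { 0F → refl ; 1F → refl ; 2F → refl }
  e : Preimage identity
  e = involution-preimage identity λ { 0F → refl ; 1F → refl ; 2F → refl }
  φ-product : ∀ {ρ π} (g : Preimage ρ) (h : Preimage π) → φ (proj₁ g ∙ proj₁ h) ≡ compose3 G ρ π
  φ-product (g , refl) (h , refl) = φ-∙ g h
  -- Injectivity of φ makes the preimage of the identity idempotent, and the only idempotent of a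
  -- group is `ε`.
  e≡ε : proj₁ e ≡ ε
  e≡ε = identityʳ-unique (proj₁ e) (proj₁ e) (φ-injective (trans (φ-product e e) (sym (proj₂ e))))
  φ-ε : φ ε ≡ identity
  φ-ε = trans (cong φ (sym e≡ε)) (proj₂ e)
  ≢ε : ∀ {ρ} (g : Preimage ρ) → ρ ≢ identity → proj₁ g ≢ ε
  ≢ε (g , φg≡ρ) ρ≢ g≡ε = ρ≢ (trans (sym φg≡ρ) (trans (cong φ g≡ε) φ-ε))
  square : ∀ {ρ} (g : Preimage ρ) → compose3 G ρ ρ ≡ identity → proj₁ g ∙ proj₁ g ≡ ε
  square g ρ² = φ-injective (trans (φ-product g g) (trans ρ² (sym φ-ε)))
  non-commuting : proj₁ a ∙ proj₁ b ≢ proj₁ b ∙ proj₁ a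
  non-commuting eq = contradiction (trans (sym (φ-product a b)) (trans (cong φ eq) (φ-product b a))) λ ()

theorem2p12 : (G : FiniteGroup) → CayleyIntegral G →
    (HasNonCommutingInvolutions G ⇔ IsomorphicToS3 G)
theorem2p12 G cayleyIntegral = mk⇔
  (λ (x , y , ix , iy , x≁y) → CayleyIntegralGroup.InvolutionsOfS₃.isomorphism G cayleyIntegral ix iy x≁y)
  (S₃⇒nonCommutingInvolutions G)
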